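{- Let $p>3$ be a prime and let $\alpha$ be a $p$-adic integer. Then $$\sum_{k=0}^{p-1}(-1)^k(2k+\alpha)\frac{(\alpha)_k^3}{(1)_k^3}\equiv (-1)^{\langle -\alpha\rangle_p}(\alpha+\langle -\alpha\rangle_p)+(\alpha+\langle -\alpha\rangle_p)^3E_{p-3}(\alpha)\pmod{p^4},$$ and $$\sum_{k=0}^{\langle -\alpha\rangle_p}(-1)^k(2k+\alpha)\frac{(\alpha)_k^3}{(1)_k^3}\equiv (-1)^{\langle -\alpha\rangle_p}(\alpha+\langle -\alpha\rangle_p)+(\alpha+\langle -\alpha\rangle_p)^3E_{p-3}(\alpha)\pmod{p^4}.$$
   Context: $(x)_k=x(x+1)\cdots(x+k-1)$ is the Pochhammer symbol, with $(x)_0=1$. For a $p$-adic integer $x$, $\langle x\rangle_p\in\{0,1,\dots,p-1\}$ denotes the least non-negative residue of $x$ modulo $p$. The Euler polynomials $E_n(x)$ are defined by $\sum_{n\ge 0}E_n(x)\frac{t^n}{n!}=\frac{2e^{xt}}{e^t+1}$. Congruences modulo $p^4$ are in the ring $\mathbb{Z}_p$ of $p$-adic integers, i.e. the difference lies in $p^4\mathbb{Z}_p$. -}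

module Defs where

open import Algebra.Bundles using (RawSemiring; RawRing)
import Algebra.Definitions.RawMonoid as RawMonoidDefs
import Algebra.Definitions.RawSemiring as RawSemiringDefs
open import Data.Fin.Base using (toℕ)
open import Data.Integer.Base as ℤ using (ℤ; +_)
import Data.Integer.DivMod as ℤ
open import Data.Integer.Divisibility.Signed using (_∣_; divides; ∣m∣n⇒∣m+n; ∣n⇒∣m*n; ∣m⇒∣m*n; ∣m⇒∣-m)
import Data.Integer.Properties as ℤ
open import Data.Integer.Tactic.RingSolver using (solve-∀)
open import Data.List.Base using (List; []; _∷_; _++_; map; foldr; replicate)
open import Data.Nat.Base as ℕ using (ℕ; zero; suc; NonZero; _!)
open import Data.Nat.Primality using (Prime; prime⇒nonZero)
import Data.Nat.Properties as ℕ
open import Data.Product.Base using (∃-syntax)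
open import Data.Rational.Base as ℚ using (ℚ; 0ℚ; 1ℚ; ↥_; ↧ₙ_)
open import Level using (0ℓ)
open import Relation.Binary.PropositionalEquality using (_≡_; subst)

pochhammer : ∀ {c ℓ} (R : RawSemiring c ℓ) → let open RawSemiring R in
             Carrier → ℕ → Carrier
pochhammer R x zero    = 1#
  where open RawSemiring R
pochhammer R x (suc k) = x * pochhammer R (x + 1#) k
  where open RawSemiring R

------------------------------------------------------------------------
-- p-adic integers

-- The inverse limit of the rings ℤ/pⁿℤ.  A residue class modulo pⁿ is
-- given by any integer representing it, and equality is taken accordingly.

record ℤₚ (p : ℕ) : Set where
  constructor mkℤₚ
  field
    approx   : ℕ → ℤ
    coherent : ∀ n → + (p ℕ.^ n) ∣ approx (suc n) ℤ.- approx n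

open ℤₚ public

infix 4 _≈_

_≈_ : ∀ {p} → ℤₚ p → ℤₚ p → Set
_≈_ {p} x y = ∀ n → + (p ℕ.^ n) ∣ approx x n ℤ.- approx y n

fromℤ : ∀ {p} → ℤ → ℤₚ p
fromℤ i .approx n = i
fromℤ i .coherent n = divides (+ 0) (ℤ.+-inverseʳ i)

fromℕ : ∀ {p} → ℕ → ℤₚ p
fromℕ n = fromℤ (+ n)

private
  +-diff : ∀ a a′ b b′ → (a′ ℤ.- a) ℤ.+ (b′ ℤ.- b) ≡ (a′ ℤ.+ b′) ℤ.- (a ℤ.+ b)
  +-diff = solve-∀

  *-diff : ∀ a a′ b b′ →
           a′ ℤ.* (b′ ℤ.- b) ℤ.+ (a′ ℤ.- a) ℤ.* b ≡ a′ ℤ.* b′ ℤ.- a ℤ.* b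
  *-diff = solve-∀

  neg-diff : ∀ a a′ → ℤ.- (a′ ℤ.- a) ≡ ℤ.- a′ ℤ.- ℤ.- a
  neg-diff = solve-∀

infix  8 -_
infixl 7 _*_
infixl 6 _+_
infixr 8 _^_

_+_ : ∀ {p} → ℤₚ p → ℤₚ p → ℤₚ p
(x + y) .approx n = approx x n ℤ.+ approx y n
_+_ {p} x y .coherent n = subst (+ (p ℕ.^ n) ∣_)
  (+-diff (approx x n) (approx x (suc n)) (approx y n) (approx y (suc n)))
  (∣m∣n⇒∣m+n (coherent x n) (coherent y n))

_*_ : ∀ {p} → ℤₚ p → ℤₚ p → ℤₚ p
(x * y) .approx n = approx x n ℤ.* approx y n
_*_ {p} x y .coherent n = subst (+ (p ℕ.^ n) ∣_)
  (*-diff (approx x n) (approx x (suc n)) (approx y n) (approx y (suc n)))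
  (∣m∣n⇒∣m+n (∣n⇒∣m*n (approx x (suc n)) (coherent y n))
             (∣m⇒∣m*n (approx y n) (coherent x n)))

-_ : ∀ {p} → ℤₚ p → ℤₚ p
(- x) .approx n = ℤ.- approx x n
-_ {p} x .coherent n = subst (+ (p ℕ.^ n) ∣_)
  (neg-diff (approx x n) (approx x (suc n)))
  (∣m⇒∣-m (coherent x n))

ℤₚ-rawRing : ℕ → RawRing 0ℓ 0ℓ
ℤₚ-rawRing p = record
  { Carrier = ℤₚ p
  ; _≈_     = _≈_
  ; _+_     = _+_
  ; _*_     = _*_
  ; -_      = -_
  ; 0#      = fromℕ 0
  ; 1#      = fromℕ 1
  }

_^_ : ∀ {p} → ℤₚ p → ℕ → ℤₚ p
_^_ {p} = RawSemiringDefs._^_ (RawRing.rawSemiring (ℤₚ-rawRing p))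

⟨_⟩ : ∀ {p} {{_ : Prime p}} → ℤₚ p → ℕ
⟨_⟩ {p} {{pr}} x = approx x 1 ℤ.%ℕ p
  where instance _ = prime⇒nonZero pr

------------------------------------------------------------------------
-- p-adic numbers

-- For p prime, every nonzero p-adic integer is a unit times a power of p,
-- so inverting the positive integers in ℤₚ gives its field of fractions.
-- As ℤₚ has no torsion, fractions are compared by cross-multiplication.

infixl 7 _/_

record ℚₚ (p : ℕ) : Set where
  constructor _/_
  field
    numerator         : ℤₚ p
    denominator       : ℕ
    .{{denominator≢0}} : NonZero denominator

infix  4 _≋_
infix  8 ⊝_
infixl 7 _⊗_
infixl 6 _⊕_

_≋_ : ∀ {p} → ℚₚ p → ℚₚ p → Set
(x / m) ≋ (y / n) = fromℕ n * x ≈ fromℕ m * y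

_⊕_ : ∀ {p} → ℚₚ p → ℚₚ p → ℚₚ p
(x / m) ⊕ (y / n) = (fromℕ n * x + fromℕ m * y) / (m ℕ.* n)
  where instance _ = ℕ.m*n≢0 m n

_⊗_ : ∀ {p} → ℚₚ p → ℚₚ p → ℚₚ p
(x / m) ⊗ (y / n) = (x * y) / (m ℕ.* n)
  where instance _ = ℕ.m*n≢0 m n

⊝_ : ∀ {p} → ℚₚ p → ℚₚ p
⊝ (x / m) = (- x) / m

ι : ∀ {p} → ℤₚ p → ℚₚ p
ι x = x / 1

fromℚ : ∀ {p} → ℚ → ℚₚ p
fromℚ q = fromℤ (↥ q) / ↧ₙ q

ℚₚ-rawRing : ℕ → RawRing 0ℓ 0ℓ
ℚₚ-rawRing p = record
  { Carrier = ℚₚ p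
  ; _≈_     = _≋_
  ; _+_     = _⊕_
  ; _*_     = _⊗_
  ; -_      = ⊝_
  ; 0#      = ι (fromℕ 0)
  ; 1#      = ι (fromℕ 1)
  }

-- The sum of f k over 0 ≤ k < n.

∑[_] : ∀ {p} (n : ℕ) → (ℕ → ℚₚ p) → ℚₚ p
∑[_] {p} n f =
  RawMonoidDefs.sum (RawRing.+-rawMonoid (ℚₚ-rawRing p)) {n} (λ i → f (toℕ i))

-- The difference lies in pⁿℤₚ.

infix 3 _≡_[mod-p^_]

_≡_[mod-p^_] : ∀ {p} → ℚₚ p → ℚₚ p → ℕ → Set
_≡_[mod-p^_] {p} x y n = ∃[ z ] x ⊕ ⊝ y ≋ ι (fromℕ (p ℕ.^ n) * z)

------------------------------------------------------------------------
-- The summands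

pochhammer≢0 : ∀ m .{{_ : NonZero m}} k → NonZero (pochhammer ℕ.+-*-rawSemiring m k)
pochhammer≢0 m       zero    = _
pochhammer≢0 (suc m) (suc k) = ℕ.m*n≢0 (suc m) _
  {{_}} {{pochhammer≢0 (suc m ℕ.+ 1) k}}

-- (-1)ᵏ (2k + α) (α)ₖ³ / (1)ₖ³, with (1)ₖ taken in ℕ so that it can serve
-- as a denominator.

summand : ∀ {p} → ℤₚ p → ℕ → ℚₚ p
summand {p} α k =
  ι ((- fromℕ 1) ^ k * (fromℕ 2 * fromℕ k + α)) ⊗ (αₖ ^ 3 / 1ₖ ℕ.^ 3)
  where
  αₖ : ℤₚ p
  αₖ = pochhammer (RawRing.rawSemiring (ℤₚ-rawRing p)) α k

  1ₖ : ℕ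
  1ₖ = pochhammer ℕ.+-*-rawSemiring 1 k

  instance _ = ℕ.m^n≢0 1ₖ 3 {{pochhammer≢0 1 k}}

------------------------------------------------------------------------
-- Euler polynomials

-- ℚ[x], by lists of coefficients, constant term first.

Poly : Set
Poly = List ℚ

infixl 6 _+ᵖ_
infixl 7 _·_

_+ᵖ_ : Poly → Poly → Poly
[]      +ᵖ g       = g
(a ∷ f) +ᵖ []      = a ∷ f
(a ∷ f) +ᵖ (b ∷ g) = (a ℚ.+ b) ∷ (f +ᵖ g)

_·_ : ℚ → Poly → Poly
c · f = map (c ℚ.*_) f

x^ : ℕ → Poly
x^ n = replicate n 0ℚ ++ 1ℚ ∷ []

eval : ∀ {p} → Poly → ℚₚ p → ℚₚ p
eval f y = foldr (λ c v → fromℚ c ⊕ y ⊗ v) (ι (fromℕ 0)) f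

-- Long division of formal power series, A in ℚ[x][[t]] by B in ℚ[[t]]:
-- the quotient has constant term q = A₀/B₀, and the remaining coefficients
-- are those of (A - qB)/t divided by B.

divide : (A : ℕ → Poly) (B : ℕ → ℚ) .{{_ : ℚ.NonZero (B 0)}} → ℕ → Poly
divide A B zero    = (ℚ.1/ B 0) · A 0
divide A B (suc n) = divide (λ m → A (suc m) +ᵖ (ℚ.- B (suc m)) · q) B n
  where q = (ℚ.1/ B 0) · A 0

1/!_ : ℕ → ℚ
1/! n = (+ 1 ℚ./ n !) {{n ℕ.!≢0}}

2eˣᵗ : ℕ → Poly
2eˣᵗ n = (+ 2 ℚ./ 1) · (1/! n · x^ n)

eᵗ+1 : ℕ → ℚ
eᵗ+1 zero    = 1/! 0 ℚ.+ 1ℚ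
eᵗ+1 (suc n) = 1/! (suc n)

-- Eₙ(x)/n! is the coefficient of tⁿ in 2eˣᵗ/(eᵗ + 1).

E : ℕ → Poly
E n = (+ (n !) ℚ./ 1) · divide 2eˣᵗ eᵗ+1 n

{-# OPTIONS --safe #-}
module Submission where

open import Algebra.Bundles using (RawMonoid; RawRing)
import Algebra.Definitions.RawMonoid as RawMonoidDefs
import Algebra.Properties.CommutativeSemiring.Binomial as BinomialTheorem
import Algebra.Properties.Monoid.Sum as MonoidSum
import Algebra.Properties.Semiring.Exp as SemiringExp
open import Data.Fin.Base as Fin using (toℕ; inject₁)
import Data.Fin.Properties as Fin
open import Data.Integer.Base as ℤ using (ℤ; +_; 0ℤ; 1ℤ; -1ℤ)
import Data.Integer.DivMod as ℤ
open import Data.Integer.Divisibility.Signed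
  using (_∣_; divides; ∣-refl; ∣-trans; ∣m∣n⇒∣m+n; ∣n⇒∣m*n; ∣m⇒∣m*n; ∣m⇒∣-m;
         *-monoʳ-∣; *-monoˡ-∣; *-cancelʳ-∣; ∣ᵤ⇒∣)
import Data.Integer.Properties as ℤ
open import Data.Integer.Tactic.RingSolver using (solve-∀)
open import Data.List.Base using ([]; _∷_; foldr)
open import Data.Nat.Base as ℕ using (ℕ; zero; suc; NonZero; _<_; _≤_; _∸_; s≤s; z≤n; _!)
open import Data.Nat.Combinatorics using (_C_; nCk≡n!/k![n-k]!; nCn≡1)
open import Data.Nat.Combinatorics.Specification using ([n∸k]!k!∣n!)
open import Data.Nat.Coprimality using (prime⇒coprime; coprime-Bézout)
import Data.Nat.Divisibility as ℕ
import Data.Nat.DivMod as ℕ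
open import Data.Nat.GCD using (module Bézout)
open import Data.Nat.Primality
  using (Prime; euclidsLemma; ¬prime[1]; prime⇒nonZero; prime⇒irreducible)
import Data.Nat.Properties as ℕ
open import Data.Product.Base using (_×_; _,_; ∃-syntax; proj₁; proj₂)
open import Data.Rational.Base as ℚ using (ℚ; 1ℚ; ↥_; ↧_)
import Data.Rational.Properties as ℚ
open import Data.Sum.Base using (_⊎_; inj₁; inj₂)
open import Data.Vec.Functional using (Vector)
open import Function.Base using (_∘_)
open import Level using (0ℓ)
open import Relation.Binary.Bundles using (Setoid)
open import Relation.Binary.PropositionalEquality
  using (_≡_; refl; sym; trans; cong; cong₂; subst; subst₂; module ≡-Reasoning)
import Relation.Binary.Reasoning.Setoid as SetoidReasoning
open import Relation.Nullary using (yes; no; contradiction)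

-- Put ε = α + r with r = ⟨-α⟩, so that p divides ε.  With S(a, n) denoting the
-- sum of the first n terms, a Wilf–Zeilberger pair gives
--   S(a, n + 1) + S(a - 1, n + 1) = (-1)ⁿ (2a + n - 1) ((a)ₙ / n!)³.
-- Evaluating the right-hand side modulo p⁴ at a = ε - r shows that, as functions
-- of r, both S(ε - r, p) and S(ε - r, r + 1) satisfy
--   Y(r) + Y(r + 1) ≡ 2ε³ / (r + 1)².
-- By Eₙ(x) + Eₙ(x + 1) = 2xⁿ and Fermat's little theorem, so does the closed form
-- (-1)ʳ ε + ε³ Eₚ₋₃(ε - r).  The short sum and the closed form both start at ε
-- (because Eₚ₋₃(0) ≡ 0 modulo p), and the two sums coincide at r = p - 1.
-- All of this takes place in ℤ, with α replaced by its approximation modulo p⁴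
-- and 1 / (n + 1) by an inverse v n of n + 1 modulo p⁴.

-- Every correction to the leading term carries the factor ε³, which p³ divides, so its cofactor
-- matters only modulo p. There 1 / (r + 1)² may be replaced by (r + 1)ᵖ⁻³, and this is where the
-- degree p - 3 of the Euler polynomial comes from. The factor ε³ arises in two ways. The short sums
-- at r and r + 1 have different lengths, so one more term stands beside the right-hand side of the
-- Wilf-Zeilberger identity, and the lower powers of ε cancel between the two. For the long sums, ε
-- is a factor of (ε - r)ₚ₋₁ itself as long as r < p - 1; knowing (ε - r)ₚ₋₁ / (p - 1)! modulo p²
-- then determines its cube modulo p⁴. At r = 0 the long sum still has p terms and no evident value,
-- so it is compared with the short one backwards from r = p - 1. Only numbers prime to p are ever
-- inverted: the sums involve k! for k < p, and the series division up to degree p - 3 involves 2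
-- and i! for i ≤ p - 3.

module Integers where
  open import Data.Integer.Base using (_+_; _*_; _-_; -_; _^_)
  module Binomial = BinomialTheorem ℤ.+-*-commutativeSemiring
  open MonoidSum ℤ.+-0-monoid using (sum; sum-init-last)
  module Multiple = RawMonoidDefs ℤ.+-0-rawMonoid
  module Exp = SemiringExp ℤ.+-*-semiring

  -- Congruences between integers

  private variable
    M M′ x x′ y y′ z : ℤ

  infix 4 _≅_mod_

  -- A record, because `x` and `y` could not be inferred from the bare divisibility: a difference
  -- does not determine its two terms.
  record _≅_mod_ (x y M : ℤ) : Set where
    constructor congruent
    field
      ∣-difference : M ∣ x - y

  open _≅_mod_ public

  module _ where
    private
      neg-difference : ∀ x y → - (x - y) ≡ y - x
      neg-difference = solve-∀

      difference-+ : ∀ x y z → (x - y) + (y - z) ≡ x - z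
      difference-+ = solve-∀

      +-difference : ∀ x x′ y y′ → (x - x′) + (y - y′) ≡ (x + y) - (x′ + y′)
      +-difference = solve-∀

      *-difference : ∀ x x′ y y′ → (x - x′) * y + x′ * (y - y′) ≡ x * y - x′ * y′
      *-difference = solve-∀

      -‿difference : ∀ x x′ → - (x - x′) ≡ - x - - x′
      -‿difference = solve-∀

    ≅-reflexive : x ≡ y → x ≅ y mod M
    ≅-reflexive {x} refl = congruent (divides 0ℤ (ℤ.+-inverseʳ x))

    ≅-refl : x ≅ x mod M
    ≅-refl = ≅-reflexive refl

    ≅-sym : x ≅ y mod M → y ≅ x mod M
    ≅-sym {x} {y} (congruent d) = congruent (subst (_ ∣_) (neg-difference x y) (∣m⇒∣-m d))

    ≅-trans : x ≅ y mod M → y ≅ z mod M → x ≅ z mod M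
    ≅-trans {x} {y} {M} {z} (congruent d) (congruent e) =
      congruent (subst (_ ∣_) (difference-+ x y z) (∣m∣n⇒∣m+n d e))

    +-cong : x ≅ x′ mod M → y ≅ y′ mod M → x + y ≅ x′ + y′ mod M
    +-cong {x} {x′} {M} {y} {y′} (congruent d) (congruent e) =
      congruent (subst (_ ∣_) (+-difference x x′ y y′) (∣m∣n⇒∣m+n d e))

    *-cong : x ≅ x′ mod M → y ≅ y′ mod M → x * y ≅ x′ * y′ mod M
    *-cong {x} {x′} {M} {y} {y′} (congruent d) (congruent e) =
      congruent (subst (_ ∣_) (*-difference x x′ y y′) (∣m∣n⇒∣m+n (∣m⇒∣m*n y d) (∣n⇒∣m*n x′ e)))

    -‿cong : x ≅ x′ mod M → - x ≅ - x′ mod M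
    -‿cong {x} {x′} (congruent d) = congruent (subst (_ ∣_) (-‿difference x x′) (∣m⇒∣-m d))

  +-congˡ : ∀ z → x ≅ y mod M → z + x ≅ z + y mod M
  +-congˡ z = +-cong (≅-refl {z})

  *-congˡ : ∀ z → x ≅ y mod M → z * x ≅ z * y mod M
  *-congˡ z = *-cong (≅-refl {z})

  *-congʳ : ∀ z → x ≅ y mod M → x * z ≅ y * z mod M
  *-congʳ z x≅y = *-cong x≅y (≅-refl {z})

  ^-cong : ∀ n → x ≅ x′ mod M → x ^ n ≅ x′ ^ n mod M
  ^-cong zero    _   = ≅-refl
  ^-cong (suc n) x≅x′ = *-cong x≅x′ (^-cong n x≅x′)

  ≅-weaken : M′ ∣ M → x ≅ y mod M → x ≅ y mod M′
  ≅-weaken M′∣M (congruent d) = congruent (∣-trans M′∣M d)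

  module ≅-Reasoning (M : ℤ) where
    ≅-setoid : Setoid 0ℓ 0ℓ
    ≅-setoid = record
      { _≈_           = λ x y → x ≅ y mod M
      ; isEquivalence = record { refl = ≅-refl ; sym = ≅-sym ; trans = ≅-trans }
      }

    open SetoidReasoning ≅-setoid public

  ∣⇒≅0 : M ∣ x → x ≅ 0ℤ mod M
  ∣⇒≅0 {x = x} d = congruent (subst (_ ∣_) (sym (ℤ.+-identityʳ x)) d)

  ≅0⇒∣ : x ≅ 0ℤ mod M → M ∣ x
  ≅0⇒∣ {x} (congruent d) = subst (_ ∣_) (ℤ.+-identityʳ x) d

  -- Here and in `combination₂`, a difference is exhibited as a combination of differences already
  -- divisible by the modulus, so that what remains is an identity in ℤ for the ring solver.
  combination₁ : ∀ c → x ≅ x′ mod M → y - y′ ≡ c * (x - x′) → y ≅ y′ mod M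
  combination₁ c (congruent d) eq = congruent (subst (_ ∣_) (sym eq) (∣n⇒∣m*n c d))

  combination₂ : ∀ c d → x ≅ x′ mod M → y ≅ y′ mod M → ∀ {z z′} →
                 z - z′ ≡ c * (x - x′) + d * (y - y′) → z ≅ z′ mod M
  combination₂ c d (congruent e) (congruent f) eq =
    congruent (subst (_ ∣_) (sym eq) (∣m∣n⇒∣m+n (∣n⇒∣m*n c e) (∣n⇒∣m*n d f)))

  *-cancel-unit : ∀ m u → m * u ≅ + 1 mod M → m * x ≅ m * y mod M → x ≅ y mod M
  *-cancel-unit {M} {x} {y} m u mu≅1 mx≅my =
    combination₂ u (- (x - y)) mx≅my mu≅1 (lemma m u x y)
    where
    lemma : ∀ m u x y → x - y ≡ u * (m * x - m * y) + - (x - y) * (m * u - + 1)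
    lemma = solve-∀

  ∣-∣-* : ∀ {k l} → k ∣ x → l ∣ y → k * l ∣ x * y
  ∣-∣-* {x} {y} {k} {l} k∣x l∣y = ∣-trans (*-monoˡ-∣ l k∣x) (*-monoʳ-∣ x l∣y)

  -- The alternating sums and their Wilf-Zeilberger identity

  sgn : ℕ → ℤ
  sgn n = -1ℤ ^ n

  ∑ : ℕ → (ℕ → ℤ) → ℤ
  ∑ zero    f = 0ℤ
  ∑ (suc n) f = ∑ n f + f n

  module RisingRatio (v : ℕ → ℤ) where

    -- If v n is the inverse of n + 1, this is (a)ₙ / n!.
    ρ : ℤ → ℕ → ℤ
    ρ a zero    = 1ℤ
    ρ a (suc n) = (a + + n) * v n * ρ a n

    term : ℤ → ℕ → ℤ
    term a k = sgn k * (+ 2 * + k + a) * (ρ a k * ρ a k * ρ a k)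

    -- Both sides are (a - 1)ₙ₊₁ / n!, with the last and the first factor split off. The inverses
    -- enter both sides alike, so the equality is exact.
    ρ-pred : ∀ a n → (a - + 1 + + n) * ρ (a - + 1) n ≡ (a - + 1) * ρ a n
    ρ-pred a zero    = cong (_* 1ℤ) (ℤ.+-identityʳ (a - + 1))
    ρ-pred a (suc n) = begin
      (a - + 1 + + suc n) * ((a - + 1 + + n) * v n * ρ (a - + 1) n)
        ≡⟨ reorder a (+ n) (v n) (ρ (a - + 1) n) ⟩
      (a + + n) * v n * ((a - + 1 + + n) * ρ (a - + 1) n)
        ≡⟨ cong ((a + + n) * v n *_) (ρ-pred a n) ⟩
      (a + + n) * v n * ((a - + 1) * ρ a n)
        ≡⟨ reorder′ a (+ n) (v n) (ρ a n) ⟩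
      (a - + 1) * ((a + + n) * v n * ρ a n) ∎
      where
      open ≡-Reasoning

      reorder : ∀ a n v ρ → (a - + 1 + (+ 1 + n)) * ((a - + 1 + n) * v * ρ)
                          ≡ (a + n) * v * ((a - + 1 + n) * ρ)
      reorder = solve-∀

      reorder′ : ∀ a n v ρ → (a + n) * v * ((a - + 1) * ρ) ≡ (a - + 1) * ((a + n) * v * ρ)
      reorder′ = solve-∀

    ρ-pred-suc : ∀ a n → ρ (a - + 1) (suc n) ≡ (a - + 1) * v n * ρ a n
    ρ-pred-suc a n = begin
      (a - + 1 + + n) * v n * ρ (a - + 1) n   ≡⟨ reorder (a - + 1 + + n) (v n) (ρ (a - + 1) n) ⟩
      v n * ((a - + 1 + + n) * ρ (a - + 1) n) ≡⟨ cong (v n *_) (ρ-pred a n) ⟩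
      v n * ((a - + 1) * ρ a n)               ≡⟨ reorder (a - + 1) (v n) (ρ a n) ⟨
      (a - + 1) * v n * ρ a n                 ∎
      where
      open ≡-Reasoning

      reorder : ∀ x y z → x * y * z ≡ y * (x * z)
      reorder = solve-∀

    module _ {N : ℕ} (v-inverse : ∀ n → n < N → + suc n * v n ≅ + 1 mod M) where

      -- A Wilf–Zeilberger pair: term a k + term (a - 1) k = G (k + 1) - G k, where
      -- G k = (-1)ᵏ⁻¹ (k + 2a - 2) ((a)ₖ₋₁ / (k - 1)!)³.
      ∑-term-pred : ∀ a n → n ≤ N →
        ∑ (suc n) (term a) + ∑ (suc n) (term (a - + 1))
          ≅ sgn n * (+ 2 * a + + n - + 1) * (ρ a n * ρ a n * ρ a n) mod M
      ∑-term-pred a zero    _    = ≅-reflexive (lemma a)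
        where
        lemma : ∀ a → (+ 0 + + 1 * (+ 0 + a) * + 1) + (+ 0 + + 1 * (+ 0 + (a - + 1)) * + 1)
                    ≡ + 1 * (+ 2 * a + + 0 - + 1) * + 1
        lemma = solve-∀
      ∑-term-pred a (suc n) n<N = combination₂ (+ 1) c (∑-term-pred a n (ℕ.<⇒≤ n<N))
        (v-inverse n n<N)
        (trans (cong difference (ρ-pred-suc a n))
               (lemma (∑ (suc n) (term a)) (∑ (suc n) (term (a - + 1))) (sgn n) (ρ a n) (v n) a (+ n)))
        where
        t c : ℤ
        t = + suc n * v n
        -- The new terms contain `v n` cubed, so the identity is exact up to t³ - 1 = (t - 1)(t² + t
        -- + 1).
        c = - (sgn n * (ρ a n * ρ a n * ρ a n) * (+ 2 * a + + n - + 1) * (t * t + t + + 1))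

        difference : ℤ → ℤ
        difference ρ″ =
          ∑ (suc (suc n)) (term a)
            + (∑ (suc n) (term (a - + 1)) + sgn (suc n) * (+ 2 * + suc n + (a - + 1)) * (ρ″ * ρ″ * ρ″))
            - sgn (suc n) * (+ 2 * a + + suc n - + 1) * (ρ a (suc n) * ρ a (suc n) * ρ a (suc n))

        lemma : ∀ P Q s ρ v a n →
          let q = + 1 + n ; s′ = -1ℤ * s ; t = q * v
              ρ′ = (a + n) * v * ρ ; ρ″ = (a - + 1) * v * ρ in
          (P + s′ * (+ 2 * q + a) * (ρ′ * ρ′ * ρ′)) + (Q + s′ * (+ 2 * q + (a - + 1)) * (ρ″ * ρ″ * ρ″))
            - s′ * (+ 2 * a + q - + 1) * (ρ′ * ρ′ * ρ′)
          ≡ + 1 * (P + Q - s * (+ 2 * a + n - + 1) * (ρ * ρ * ρ))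
            + - (s * (ρ * ρ * ρ) * (+ 2 * a + n - + 1) * (t * t + t + + 1)) * (t - + 1)
        lemma = solve-∀

  sgn-square : ∀ n → sgn n * sgn n ≡ 1ℤ
  sgn-square zero    = refl
  sgn-square (suc n) = trans (lemma (sgn n)) (sgn-square n)
    where
    lemma : ∀ s → -1ℤ * s * (-1ℤ * s) ≡ s * s
    lemma = solve-∀

  -- Sequences with the same recurrence

  module _ {Y Z c : ℕ → ℤ} {N : ℕ}
    (Y-rec : ∀ r → r < N → Y r + Y (suc r) ≅ c r mod M)
    (Z-rec : ∀ r → r < N → Z r + Z (suc r) ≅ c r mod M) where

    -- Subtracting the recurrences leaves a sequence that changes sign at each step, so agreement at
    -- one index spreads in both directions.
    difference-alternates : ∀ r → r ≤ N → Y r - Z r ≅ sgn r * (Y 0 - Z 0) mod M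
    difference-alternates zero    _   = ≅-reflexive (sym (ℤ.*-identityˡ (Y 0 - Z 0)))
    difference-alternates (suc r) r<N = combination₂ (+ 1) (- + 1)
      (≅-trans (Y-rec r r<N) (≅-sym (Z-rec r r<N))) (difference-alternates r (ℕ.<⇒≤ r<N))
      (lemma (Y r) (Y (suc r)) (Z r) (Z (suc r)) (sgn r) (Y 0 - Z 0))
      where
      lemma : ∀ y y′ z z′ s d → y′ - z′ - -1ℤ * s * d
            ≡ + 1 * (y + y′ - (z + z′)) + - + 1 * (y - z - s * d)
      lemma = solve-∀

    ≅-from-start : Y 0 ≅ Z 0 mod M → ∀ r → r ≤ N → Y r ≅ Z r mod M
    ≅-from-start (congruent M∣Y₀-Z₀) r r≤N = congruent (≅0⇒∣
      (≅-trans (difference-alternates r r≤N) (∣⇒≅0 (∣n⇒∣m*n (sgn r) M∣Y₀-Z₀))))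

    ≅-from-end : Y N ≅ Z N mod M → ∀ r → r ≤ N → Y r ≅ Z r mod M
    ≅-from-end (congruent M∣Y-Z) = ≅-from-start (congruent (subst (_ ∣_)
      (trans (sym (ℤ.*-assoc (sgn N) (sgn N) (Y 0 - Z 0)))
             (trans (cong (_* (Y 0 - Z 0)) (sgn-square N)) (ℤ.*-identityˡ (Y 0 - Z 0))))
      (∣n⇒∣m*n (sgn N) (≅0⇒∣
        (≅-trans (≅-sym (difference-alternates N ℕ.≤-refl)) (∣⇒≅0 M∣Y-Z))))))

  module _ {P : ℤ} where
    cube*-cong : P ∣ z → x ≅ y mod P → z * z * z * x ≅ z * z * z * y mod P ^ 4
    cube*-cong {z} {x} {y} P∣z (congruent P∣x-y) = congruent (subst (P ^ 4 ∣_) (lemma z x y)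
      (∣-∣-* P∣z (∣-∣-* P∣z (∣-∣-* P∣z (subst (_∣ x - y) (sym (ℤ.*-identityʳ P)) P∣x-y)))))
      where
      lemma : ∀ z x y → z * (z * (z * (x - y))) ≡ z * z * z * x - z * z * z * y
      lemma = solve-∀

    -- In x³ - y³ = (x - y)(x² + xy + y²) each of the two factors is divisible by P².
    cube-cong : P ∣ y → x ≅ y mod P * P → x * x * x ≅ y * y * y mod P ^ 4
    cube-cong {y} {x} P∣y (congruent P²∣x-y) = congruent (subst (P ^ 4 ∣_) (lemma x y)
      (subst (_∣ (x - y) * (x * x + x * y + y * y)) (modulus P) (∣-∣-* P²∣x-y
        (∣m∣n⇒∣m+n (∣m∣n⇒∣m+n (∣-∣-* P∣x P∣x) (∣-∣-* P∣x P∣y)) (∣-∣-* P∣y P∣y)))))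
      where
      P∣x : P ∣ x
      P∣x = subst (P ∣_) (recombine x y) (∣m∣n⇒∣m+n (∣-trans (∣m⇒∣m*n P ∣-refl) P²∣x-y) P∣y)
        where
        recombine : ∀ x y → x - y + y ≡ x
        recombine = solve-∀

      lemma : ∀ x y → (x - y) * (x * x + x * y + y * y) ≡ x * x * x - y * y * y
      lemma = solve-∀

      modulus : ∀ P → P * P * (P * P) ≡ P * (P * (P * (P * + 1)))
      modulus = solve-∀

  P∣P⁴ : ∀ P → P ∣ P ^ 4
  P∣P⁴ P = ∣m⇒∣m*n (P ^ 3) ∣-refl

  P²∣P⁴ : ∀ P → P * P ∣ P ^ 4
  P²∣P⁴ P = divides (P * P) (lemma P)
    where
    lemma : ∀ P → P * (P * (P * (P * + 1))) ≡ P * P * (P * P)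
    lemma = solve-∀

  -- Both sums and the closed form modulo p⁴, with p = n + 1

  module Sums (n : ℕ) (sgn-n : sgn n ≡ 1ℤ) (v : ℕ → ℤ)
              (v-inverse : ∀ k → k < n → + suc k * v k ≅ + 1 mod (+ suc n) ^ 4)
              {ε : ℤ} (p∣ε : + suc n ∣ ε) where
    open RisingRatio v

    P : ℤ
    P = + suc n

    v-inverseₚ : ∀ k → k < n → + suc k * v k ≅ + 1 mod P
    v-inverseₚ k k<n = ≅-weaken (P∣P⁴ P) (v-inverse k k<n)

    v-inverse² : ∀ k → k < n → + suc k * v k ≅ + 1 mod P * P
    v-inverse² k k<n = ≅-weaken (P²∣P⁴ P) (v-inverse k k<n)

    minus-suc : ∀ k → ε - + k - + 1 ≡ ε - + suc k
    minus-suc k = lemma ε (+ k)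
      where
      lemma : ∀ ε k → ε - k - + 1 ≡ ε - (+ 1 + k)
      lemma = solve-∀

    -- Modulo p this is (-r)ᵣ / r!, whose numerator is (-r)(-r + 1)...(-1).
    ρ-at-minus : ∀ r → r ≤ n → ρ (ε - + r) r ≅ sgn r mod P
    ρ-at-minus zero    _   = ≅-refl
    ρ-at-minus (suc r) r<n = begin
      ρ (ε - + suc r) (suc r)              ≡⟨ cong (λ a → ρ a (suc r)) (minus-suc r) ⟨
      ρ (ε - + r - + 1) (suc r)            ≡⟨ ρ-pred-suc (ε - + r) r ⟩
      (ε - + r - + 1) * v r * ρ (ε - + r) r ≈⟨ *-cong factor (ρ-at-minus r (ℕ.<⇒≤ r<n)) ⟩
      -1ℤ * sgn r                          ∎
      where
      open ≅-Reasoning P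

      factor : (ε - + r - + 1) * v r ≅ -1ℤ mod P
      factor = combination₂ (v r) (- + 1) (∣⇒≅0 p∣ε) (v-inverseₚ r r<n) (lemma ε (+ r) (v r))
        where
        lemma : ∀ ε r v → (ε - r - + 1) * v - -1ℤ ≡ v * (ε - + 0) + - + 1 * ((+ 1 + r) * v - + 1)
        lemma = solve-∀

    jump : ℕ → ℤ
    jump r = ε * ε * ε * (+ 2 * (v r * v r))

    short long : ℕ → ℤ
    short r = ∑ (suc r) (term (ε - + r))
    long r = ∑ (suc n) (term (ε - + r))

    -- `short (suc r)` has one term beyond the identity for sums of r + 1 terms. With q = r + 1 and
    -- (-1)ʳ ρ³ v³ taken out, that term and the right-hand side combine by (2ε - q)q³ - (ε + q)(ε -
    -- q)³ = ε³(2q - ε).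
    short-rec : ∀ r → r < n → short r + short (suc r) ≅ jump r mod P ^ 4
    short-rec r r<n = begin
      short r + ∑ (suc (suc r)) (term (ε - + suc r))
        ≡⟨ cong (λ a → short r + ∑ (suc (suc r)) (term a)) (minus-suc r) ⟨
      short r + ∑ (suc (suc r)) (term (a - + 1))
        ≈⟨ combination₂ (+ 1) c (∑-term-pred v-inverse a r (ℕ.<⇒≤ r<n)) (v-inverse r r<n)
             (trans (cong difference (ρ-pred-suc a r))
                    (lemma (short r) (∑ (suc r) (term (a - + 1))) (sgn r) (ρ a r) (v r) ε (+ r))) ⟩
      ε * ε * ε * (sgn r * (ρ a r * ρ a r * ρ a r) * (v r * v r * v r) * (+ 2 * + suc r - ε))
        ≈⟨ cube*-cong p∣ε coefficient ⟩
      jump r ∎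
      where
      open ≅-Reasoning (P ^ 4)

      a t c : ℤ
      a = ε - + r
      t = + suc r * v r
      c = - (sgn r * (ρ a r * ρ a r * ρ a r) * (+ 2 * a + + r - + 1) * (t * t + t + + 1))

      difference : ℤ → ℤ
      difference ρ″ =
        short r + (∑ (suc r) (term (a - + 1)) + sgn (suc r) * (+ 2 * + suc r + (a - + 1)) * (ρ″ * ρ″ * ρ″))
          - ε * ε * ε * (sgn r * (ρ a r * ρ a r * ρ a r) * (v r * v r * v r) * (+ 2 * + suc r - ε))

      lemma : ∀ P Q s ρ v ε r →
        let q = + 1 + r ; a = ε - r ; t = q * v ; ρ″ = (a - + 1) * v * ρ in
        P + (Q + -1ℤ * s * (+ 2 * q + (a - + 1)) * (ρ″ * ρ″ * ρ″))
          - ε * ε * ε * (s * (ρ * ρ * ρ) * (v * v * v) * (+ 2 * q - ε))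
        ≡ + 1 * (P + Q - s * (+ 2 * a + r - + 1) * (ρ * ρ * ρ))
          + - (s * (ρ * ρ * ρ) * (+ 2 * a + r - + 1) * (t * t + t + + 1)) * (t - + 1)
      lemma = solve-∀

      unit : sgn r * (ρ a r * ρ a r * ρ a r) ≅ + 1 mod P
      unit = ≅-trans (*-congˡ (sgn r) (*-cong (*-cong h h) h))
        (≅-reflexive (trans (regroup (sgn r)) (cong₂ _*_ (sgn-square r) (sgn-square r))))
        where
        h : ρ a r ≅ sgn r mod P
        h = ρ-at-minus r (ℕ.<⇒≤ r<n)

        regroup : ∀ s → s * (s * s * s) ≡ s * s * (s * s)
        regroup = solve-∀

      coefficient : sgn r * (ρ a r * ρ a r * ρ a r) * (v r * v r * v r) * (+ 2 * + suc r - ε)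
                      ≅ + 2 * (v r * v r) mod P
      coefficient = ≅-trans (*-congʳ (+ 2 * + suc r - ε) (*-congʳ (v r * v r * v r) unit))
        (combination₂ (- (v r * v r * v r)) (+ 2 * (v r * v r)) (∣⇒≅0 p∣ε) (v-inverseₚ r r<n)
          (simplify (v r) ε (+ suc r)))
        where
        simplify : ∀ v ε q → + 1 * (v * v * v) * (+ 2 * q - ε) - + 2 * (v * v)
                           ≡ - (v * v * v) * (ε - + 0) + + 2 * (v * v) * (q * v - + 1)
        simplify = solve-∀

    private
      ε² : ε * ε ≅ 0ℤ mod P * P
      ε² = ∣⇒≅0 (∣-∣-* p∣ε p∣ε)

    -- (ε)ₖ₊₁ / (k + 1)! is ε / (k + 1) times a product of factors 1 + ε / j, and ε² vanishes modulo
    -- p².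
    ρ-at-ε : ∀ k → k < n → ρ ε (suc k) ≅ ε * v k mod P * P
    ρ-at-ε zero    _     = ≅-reflexive (lemma ε (v 0))
      where
      lemma : ∀ ε v → (ε + + 0) * v * + 1 ≡ ε * v
      lemma = solve-∀
    ρ-at-ε (suc k) 1+k<n = begin
      (ε + + suc k) * v (suc k) * ρ ε (suc k)
        ≈⟨ *-congˡ ((ε + + suc k) * v (suc k)) (ρ-at-ε k k<n) ⟩
      (ε + + suc k) * v (suc k) * (ε * v k)
        ≈⟨ combination₂ (v (suc k) * v k) (ε * v (suc k)) ε² (v-inverse² k k<n)
             (lemma ε (+ suc k) (v (suc k)) (v k)) ⟩
      ε * v (suc k) ∎
      where
      open ≅-Reasoning (P * P)

      k<n : k < n
      k<n = ℕ.<-trans (ℕ.n<1+n k) 1+k<n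

      lemma : ∀ ε q v′ v → (ε + q) * v′ * (ε * v) - ε * v′
                         ≡ v′ * v * (ε * ε - + 0) + ε * v′ * (q * v - + 1)
      lemma = solve-∀

    -- Induction through `ρ-pred`, whose left-hand factor is here ε + p - (r + 2). The bound r < n
    -- keeps ε among the factors of the numerator.
    ρ-last : ∀ r → r < n → ρ (ε - + r) n ≅ - (ε * v r) mod P * P
    ρ-last zero 0<n = base n 0<n refl
      where
      base : ∀ k → 0 < k → k ≡ n → ρ (ε - + 0) k ≅ - (ε * v 0) mod P * P
      base (suc k) _ refl = begin
        ρ (ε - + 0) n ≡⟨ cong (λ a → ρ a n) (ℤ.+-identityʳ ε) ⟩
        ρ ε n         ≈⟨ ρ-at-ε k ℕ.≤-refl ⟩
        -- 1 / (p - 1) is -1 only modulo p; the factor ε supplies the other power of p.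
        ε * v k       ≈⟨ congruent (subst (P * P ∣_) (factor ε (v k) (v 0)) (∣-∣-* p∣ε P∣v+v)) ⟩
        - (ε * v 0)   ∎
        where
        open ≅-Reasoning (P * P)

        factor : ∀ ε v v₀ → ε * (v + v₀) ≡ ε * v - - (ε * v₀)
        factor = solve-∀

        P∣v+v : P ∣ v k + v 0
        P∣v+v = ≅0⇒∣ (combination₂ (+ 1) (+ 1)
          (≅-trans (v-inverseₚ 0 0<n) (≅-sym (v-inverseₚ k ℕ.≤-refl)))
          (∣⇒≅0 (∣m⇒∣m*n (v k) (∣-refl {P}))) (lemma (+ suc k) (v k) (v 0)))
          where
          lemma : ∀ q v v₀ → v + v₀ - + 0 ≡ + 1 * (+ 1 * v₀ - q * v) + + 1 * ((+ 1 + q) * v - + 0)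
          lemma = solve-∀
    ρ-last (suc r) 1+r<n = begin
      ρ (ε - + suc r) n ≡⟨⟩
      ρ′                ≈⟨ combination₂ (- ρ′) (v (suc r)) (v-inverse² (suc r) 1+r<n) scaled
                             (solved (+ suc (suc r)) (v (suc r)) ρ′ ε) ⟩
      - (ε * v (suc r)) ∎
      where
      open ≅-Reasoning (P * P)

      ρ₀ ρ′ : ℤ
      ρ₀ = ρ (ε - + r) n
      ρ′ = ρ (ε - + suc r) n

      solved : ∀ q v ρ′ ε → ρ′ - - (ε * v) ≡ - ρ′ * (q * v - + 1) + v * (q * ρ′ - - ε)
      solved = solve-∀

      r<n : r < n
      r<n = ℕ.<-trans (ℕ.n<1+n r) 1+r<n

      relation : (ε + P - + suc (suc r)) * ρ′ ≡ (ε - + suc r) * ρ₀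
      relation = trans (cong (_* ρ′) (reshape ε (+ n) (+ r)))
        (subst (λ a → (a + + n) * ρ a n ≡ a * ρ₀) (minus-suc r) (ρ-pred (ε - + r) n))
        where
        reshape : ∀ ε n r → ε + (+ 1 + n) - (+ 2 + r) ≡ ε - (+ 1 + r) + n
        reshape = solve-∀

      evaluated : (ε - + suc r) * ρ₀ ≅ ε mod P * P
      evaluated = ≅-trans (*-congˡ (ε - + suc r) (ρ-last r r<n))
        (combination₂ (- v r) ε ε² (v-inverse² r r<n) (lemma ε (+ suc r) (v r)))
        where
        lemma : ∀ ε q v → (ε - q) * - (ε * v) - ε ≡ - v * (ε * ε - + 0) + ε * (q * v - + 1)
        lemma = solve-∀

      P∣ε+P : P ∣ ε + P
      P∣ε+P = ∣m∣n⇒∣m+n p∣ε ∣-refl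

      P∣ρ′ : P ∣ ρ′
      P∣ρ′ = ≅0⇒∣ (*-cancel-unit (+ suc (suc r)) (v (suc r)) (v-inverseₚ (suc r) 1+r<n)
        (combination₂ ρ′ (- + 1) (∣⇒≅0 P∣ε+P)
          (≅-trans (≅-reflexive relation)
            (≅-trans (≅-weaken (∣m⇒∣m*n P (∣-refl {P})) evaluated) (∣⇒≅0 p∣ε)))
          (lemma (ε + P) (+ suc (suc r)) ρ′)))
        where
        lemma : ∀ e q ρ′ → q * ρ′ - q * + 0 ≡ ρ′ * (e - + 0) + - + 1 * ((e - q) * ρ′ - + 0)
        lemma = solve-∀

      scaled : + suc (suc r) * ρ′ ≅ - ε mod P * P
      scaled = combination₂ (+ 1) (- + 1) (∣⇒≅0 (∣-∣-* P∣ε+P P∣ρ′))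
        (≅-trans (≅-reflexive relation) evaluated) (lemma (ε + P) (+ suc (suc r)) ρ′ ε)
        where
        lemma : ∀ e q ρ′ ε → q * ρ′ - - ε ≡ + 1 * (e * ρ′ - + 0) + - + 1 * ((e - q) * ρ′ - ε)
        lemma = solve-∀

    -- The factor 2(ε - r) + p - 2 is -2(r + 1) modulo p, which turns the cube of -ε / (r + 1) into
    -- 2ε³ / (r + 1)².
    long-rec : ∀ r → r < n → long r + long (suc r) ≅ jump r mod P ^ 4
    long-rec r r<n = begin
      long r + ∑ (suc n) (term (ε - + suc r))
        ≡⟨ cong (λ a → long r + ∑ (suc n) (term a)) (minus-suc r) ⟨
      long r + ∑ (suc n) (term (a - + 1))
        ≈⟨ ∑-term-pred v-inverse a n ℕ.≤-refl ⟩
      sgn n * (+ 2 * a + + n - + 1) * (ρ a n * ρ a n * ρ a n)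
        ≈⟨ *-cong (≅-reflexive (cong (_* (+ 2 * a + + n - + 1)) sgn-n))
                  (cube-cong (∣m⇒∣-m (∣m⇒∣m*n (v r) p∣ε)) (ρ-last r r<n)) ⟩
      + 1 * (+ 2 * a + + n - + 1) * (- (ε * v r) * - (ε * v r) * - (ε * v r))
        ≡⟨ regroup (+ 2 * a + + n - + 1) ε (v r) ⟩
      ε * ε * ε * (- (+ 2 * a + + n - + 1) * (v r * v r * v r))
        ≈⟨ cube*-cong p∣ε (combination₂ (+ 2 * (v r * v r)) (- (v r * v r * v r))
             (v-inverseₚ r r<n) (∣⇒≅0 (∣m∣n⇒∣m+n (∣n⇒∣m*n (+ 2) p∣ε) (∣-refl {P})))
             (lemma ε (+ r) (+ n) (v r))) ⟩
      jump r ∎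
      where
      open ≅-Reasoning (P ^ 4)

      a : ℤ
      a = ε - + r

      regroup : ∀ c ε v → + 1 * c * (- (ε * v) * - (ε * v) * - (ε * v)) ≡ ε * ε * ε * (- c * (v * v * v))
      regroup = solve-∀

      lemma : ∀ ε r n v → - (+ 2 * (ε - r) + n - + 1) * (v * v * v) - + 2 * (v * v)
        ≡ + 2 * (v * v) * ((+ 1 + r) * v - + 1) + - (v * v * v) * (+ 2 * ε + (+ 1 + n) - + 0)
      lemma = solve-∀

    module _ (e : ℤ → ℤ) (m : ℕ) (m-even : ∀ x → (- x) ^ m ≡ x ^ m)
             (e-cong : ∀ {x y} → x ≅ y mod P → e x ≅ e y mod P)
             (e-shift : ∀ x → e x + e (x + + 1) ≅ + 2 * x ^ m mod P)
             (e-0 : e 0ℤ ≅ 0ℤ mod P)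
             (v-square : ∀ k → k < n → (+ suc k) ^ m ≅ v k * v k mod P) where

      closed : ℕ → ℤ
      closed r = sgn r * ε + ε * ε * ε * e (ε - + r)

      -- The linear terms cancel by their signs. The shift rule for `e` is applied at ε - (r + 1),
      -- which is -(r + 1) modulo p, and evenness of the exponent removes the sign.
      closed-rec : ∀ r → r < n → closed r + closed (suc r) ≅ jump r mod P ^ 4
      closed-rec r r<n = begin
        closed r + closed (suc r)
          ≡⟨ regroup (sgn r) ε (e (ε - + r)) (e (ε - + suc r)) ⟩
        ε * ε * ε * (e (ε - + suc r) + e (ε - + r))
          ≈⟨ cube*-cong p∣ε coefficient ⟩
        jump r ∎
        where
        open ≅-Reasoning (P ^ 4)

        regroup : ∀ s ε e e′ → s * ε + ε * ε * ε * e + (-1ℤ * s * ε + ε * ε * ε * e′)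
                             ≡ ε * ε * ε * (e′ + e)
        regroup = solve-∀

        plus-1 : ∀ ε r → ε - r ≡ ε - (+ 1 + r) + + 1
        plus-1 = solve-∀

        ≅-minus : ε - + suc r ≅ - + suc r mod P
        ≅-minus = combination₁ (+ 1) (∣⇒≅0 p∣ε) (lemma ε (+ suc r))
          where
          lemma : ∀ ε q → ε - q - - q ≡ + 1 * (ε - + 0)
          lemma = solve-∀

        coefficient : e (ε - + suc r) + e (ε - + r) ≅ + 2 * (v r * v r) mod P
        coefficient = ≅-trans
          (≅-reflexive (cong (λ x → e (ε - + suc r) + e x) (plus-1 ε (+ r))))
          (≅-trans (e-shift (ε - + suc r)) (*-congˡ (+ 2)
            (≅-trans (^-cong m ≅-minus) (≅-trans (≅-reflexive (m-even (+ suc r))) (v-square r r<n)))))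

      short≅closed : ∀ r → r ≤ n → short r ≅ closed r mod P ^ 4
      short≅closed = ≅-from-start {Y = short} {closed} short-rec closed-rec (begin
        short 0
          ≡⟨ lemma ε ⟩
        + 1 * ε + ε * ε * ε * + 0
          ≈⟨ +-congˡ (+ 1 * ε) (cube*-cong p∣ε (≅-sym (≅-trans (e-cong ε≅0) e-0))) ⟩
        closed 0 ∎)
        where
        open ≅-Reasoning (P ^ 4)

        ε≅0 : ε - + 0 ≅ 0ℤ mod P
        ε≅0 = ≅-trans (≅-reflexive (ℤ.+-identityʳ ε)) (∣⇒≅0 p∣ε)

        lemma : ∀ ε → + 0 + + 1 * (+ 2 * + 0 + (ε - + 0)) * (+ 1 * + 1 * + 1) ≡ + 1 * ε + ε * ε * ε * + 0
        lemma = solve-∀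

      long≅closed : ∀ r → r ≤ n → long r ≅ closed r mod P ^ 4
      long≅closed r r≤n = ≅-trans
        (≅-from-end {Y = long} {short} long-rec short-rec ≅-refl r r≤n)
        (short≅closed r r≤n)

  -- Power series: convolution and division

  -- conv b d n is the coefficient of tⁿ in (∑ bᵢ tⁱ) (∑ dᵢ tⁱ).
  conv : (b d : ℕ → ℤ) → ℕ → ℤ
  conv b d zero    = b 0 * d 0
  conv b d (suc n) = b (suc n) * d 0 + conv b (d ∘ suc) n

  conv-cong : ∀ {b b′ d d′} n → (∀ i → i ≤ n → b i ≅ b′ i mod M) → (∀ i → i ≤ n → d i ≅ d′ i mod M) →
              conv b d n ≅ conv b′ d′ n mod M
  conv-cong zero    b≅b′ d≅d′ = *-cong (b≅b′ 0 z≤n) (d≅d′ 0 z≤n)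
  conv-cong (suc n) b≅b′ d≅d′ = +-cong (*-cong (b≅b′ (suc n) ℕ.≤-refl) (d≅d′ 0 z≤n))
    (conv-cong n (λ i i≤n → b≅b′ i (ℕ.m≤n⇒m≤1+n i≤n)) (λ i i≤n → d≅d′ (suc i) (s≤s i≤n)))

  conv-+ʳ : ∀ b d d′ n → conv b (λ i → d i + d′ i) n ≡ conv b d n + conv b d′ n
  conv-+ʳ b d d′ zero    = ℤ.*-distribˡ-+ (b 0) (d 0) (d′ 0)
  conv-+ʳ b d d′ (suc n) = trans
    (cong (_+_ (b (suc n) * (d 0 + d′ 0))) (conv-+ʳ b (d ∘ suc) (d′ ∘ suc) n))
    (lemma (b (suc n)) (d 0) (d′ 0) (conv b (d ∘ suc) n) (conv b (d′ ∘ suc) n))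
    where
    lemma : ∀ b d d′ c c′ → b * (d + d′) + (c + c′) ≡ b * d + c + (b * d′ + c′)
    lemma = solve-∀

  conv-*ʳ : ∀ b x d n → conv b (λ i → x * d i) n ≡ x * conv b d n
  conv-*ʳ b x d zero    = lemma (b 0) x (d 0)
    where
    lemma : ∀ b x d → b * (x * d) ≡ x * (b * d)
    lemma = solve-∀
  conv-*ʳ b x d (suc n) = trans
    (cong (_+_ (b (suc n) * (x * d 0))) (conv-*ʳ b x (d ∘ suc) n))
    (lemma (b (suc n)) x (d 0) (conv b (d ∘ suc) n))
    where
    lemma : ∀ b x d c → b * (x * d) + x * c ≡ x * (b * d + c)
    lemma = solve-∀

  conv-shiftˡ : ∀ b d n → b 0 ≡ 0ℤ → conv b d (suc n) ≡ conv (b ∘ suc) d n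
  conv-shiftˡ b d zero    b₀≡0 = trans (cong (λ c → b 1 * d 0 + c * d 1) b₀≡0)
    (ℤ.+-identityʳ (b 1 * d 0))
  conv-shiftˡ b d (suc n) b₀≡0 = cong (_+_ (b (suc (suc n)) * d 0)) (conv-shiftˡ b (d ∘ suc) n b₀≡0)

  conv-shiftʳ : ∀ b d n → d 0 ≡ 0ℤ → conv b d (suc n) ≡ conv b (d ∘ suc) n
  conv-shiftʳ b d n d₀≡0 = trans (cong (λ c → b (suc n) * c + conv b (d ∘ suc) n) d₀≡0)
    (trans (cong (_+ conv b (d ∘ suc) n) (ℤ.*-zeroʳ (b (suc n)))) (ℤ.+-identityˡ _))

  -- The Leibniz rule for the derivation t d/dt, with the second factor
  -- multiplied by tˢ so that the induction goes through.
  conv-Leibniz : ∀ b d n s →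
    (+ n + s) * conv b d n ≡ conv (λ i → + i * b i) d n + conv b (λ i → (+ i + s) * d i) n
  conv-Leibniz b d zero s = lemma s (b 0) (d 0)
    where
    lemma : ∀ s b d → (+ 0 + s) * (b * d) ≡ + 0 * b * d + b * ((+ 0 + s) * d)
    lemma = solve-∀
  conv-Leibniz b d (suc n) s = begin
    (+ suc n + s) * (b (suc n) * d 0 + conv b (d ∘ suc) n)
      ≡⟨ distribute (+ n) s (b (suc n)) (d 0) (conv b (d ∘ suc) n) ⟩
    (+ suc n + s) * (b (suc n) * d 0) + (+ n + (+ 1 + s)) * conv b (d ∘ suc) n
      ≡⟨ cong (_+_ ((+ suc n + s) * (b (suc n) * d 0))) (conv-Leibniz b (d ∘ suc) n (+ 1 + s)) ⟩
    (+ suc n + s) * (b (suc n) * d 0) + (L + conv b (λ i → (+ i + (+ 1 + s)) * d (suc i)) n)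
      ≡⟨ cong (λ c → (+ suc n + s) * (b (suc n) * d 0) + (L + c))
              (conv-cong-≡ n (λ i → cong (_* d (suc i)) (shift (+ i) s))) ⟩
    (+ suc n + s) * (b (suc n) * d 0) + (L + R)
      ≡⟨ regroup (+ suc n) s (b (suc n)) (d 0) L R ⟩
    + suc n * b (suc n) * d 0 + L + (b (suc n) * ((+ 0 + s) * d 0) + R) ∎
    where
    open ≡-Reasoning

    L R : ℤ
    L = conv (λ i → + i * b i) (d ∘ suc) n
    R = conv b (λ i → (+ suc i + s) * d (suc i)) n

    conv-cong-≡ : ∀ {d d′} n → (∀ i → d i ≡ d′ i) → conv b d n ≡ conv b d′ n
    conv-cong-≡ zero    eq = cong (b 0 *_) (eq 0)
    conv-cong-≡ (suc n) eq = cong₂ _+_ (cong (b (suc n) *_) (eq 0)) (conv-cong-≡ n (eq ∘ suc))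

    distribute : ∀ n s b d c → (+ 1 + n + s) * (b * d + c)
                             ≡ (+ 1 + n + s) * (b * d) + (n + (+ 1 + s)) * c
    distribute = solve-∀

    shift : ∀ i s → i + (+ 1 + s) ≡ + 1 + i + s
    shift = solve-∀

    regroup : ∀ q s b d L R → (q + s) * (b * d) + (L + R) ≡ q * b * d + L + (b * ((+ 0 + s) * d) + R)
    regroup = solve-∀

  -- A series with unit constant term is not a zero divisor: once `f 0` vanishes, the hypothesis
  -- passes to f / t in degrees one lower.
  conv-cancel : ∀ {b} h → b 0 * h ≅ + 1 mod M → ∀ f n →
                (∀ i → i ≤ n → conv b f i ≅ 0ℤ mod M) → f n ≅ 0ℤ mod M
  conv-cancel {M} {b} h b₀h≅1 f zero    eq =
    *-cancel-unit (b 0) h b₀h≅1 (≅-trans (eq 0 z≤n) (≅-reflexive (sym (ℤ.*-zeroʳ (b 0)))))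
  conv-cancel {M} {b} h b₀h≅1 f (suc n) eq = conv-cancel {b = b} h b₀h≅1 (f ∘ suc) n λ i i≤n →
    combination₂ (+ 1) (- b (suc i)) (eq (suc i) (s≤s i≤n))
      (conv-cancel {b = b} h b₀h≅1 f zero (λ { zero _ → eq 0 z≤n }))
      (lemma (b (suc i)) (f 0) (conv b (f ∘ suc) i))
    where
    lemma : ∀ b f c → c - + 0 ≡ + 1 * (b * f + c - + 0) + - b * (f - + 0)
    lemma = solve-∀

  -- Mirrors Defs.divide, with h in the role of the inverse of b 0.
  quotient : (h : ℤ) (b a : ℕ → ℤ) → ℕ → ℤ
  quotient h b a zero    = h * a 0
  quotient h b a (suc n) = quotient h b (λ i → a (suc i) + - b (suc i) * (h * a 0)) n

  conv-quotient : ∀ {b} h → b 0 * h ≅ + 1 mod M → ∀ a n → conv b (quotient h b a) n ≅ a n mod M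
  conv-quotient {M} {b} h b₀h≅1 a zero    = combination₁ (a 0) b₀h≅1 (lemma (b 0) h (a 0))
    where
    lemma : ∀ b h a → b * (h * a) - a ≡ a * (b * h - + 1)
    lemma = solve-∀
  conv-quotient {M} {b} h b₀h≅1 a (suc n) = ≅-trans
    (+-congˡ (b (suc n) * (h * a 0)) (conv-quotient h b₀h≅1 (λ i → a (suc i) + - b (suc i) * (h * a 0)) n))
    (≅-reflexive (lemma (b (suc n)) (h * a 0) (a (suc n))))
    where
    lemma : ∀ b c a → b * c + (a + - b * c) ≡ a
    lemma = solve-∀

  quotient-cong : ∀ h b {a a′} n → (∀ i → a i ≅ a′ i mod M) →
                  quotient h b a n ≅ quotient h b a′ n mod M
  quotient-cong h b zero    a≅a′ = *-congˡ h (a≅a′ 0)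
  quotient-cong h b (suc n) a≅a′ = quotient-cong h b n λ i →
    +-cong (a≅a′ (suc i)) (*-congˡ (- b (suc i)) (*-congˡ h (a≅a′ 0)))

  -- Values of Euler polynomials modulo `M`

  module EulerValues (v : ℕ → ℤ) where

    -- If v n is the inverse of n + 1, this is 1 / n!.
    w : ℕ → ℤ
    w zero    = 1ℤ
    w (suc n) = w n * v n

    expˣ : ℤ → ℕ → ℤ
    expˣ x n = w n * x ^ n

    exp+1 : ℕ → ℤ
    exp+1 zero    = w 0 + 1ℤ
    exp+1 (suc n) = w (suc n)

    2expˣ : ℤ → ℕ → ℤ
    2expˣ x n = + 2 * expˣ x n

    -- `v 1`, the inverse of 2, serves as reciprocal of the constant term of eᵗ + 1.
    eulerSeries : ℤ → ℕ → ℤ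
    eulerSeries x = quotient (v 1) exp+1 (2expˣ x)

    euler : ℕ → ℤ → ℤ
    euler n x = + (n !) * eulerSeries x n

    conv-exp+1 : ∀ d n → conv exp+1 d n ≡ conv w d n + d n
    conv-exp+1 d zero    = lemma (d 0)
      where
      lemma : ∀ d → (+ 1 + + 1) * d ≡ + 1 * d + d
      lemma = solve-∀
    conv-exp+1 d (suc n) = trans (cong (_+_ (w (suc n) * d 0)) (conv-exp+1 (d ∘ suc) n))
      (sym (ℤ.+-assoc (w (suc n) * d 0) (conv w (d ∘ suc) n) (d (suc n))))

    euler-cong : ∀ n → x ≅ y mod M → euler n x ≅ euler n y mod M
    euler-cong n x≅y = *-congˡ (+ (n !)) (quotient-cong (v 1) exp+1 n λ i →
      *-congˡ (+ 2) (*-congˡ (w i) (^-cong i x≅y)))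

    module _ {N : ℕ} (v-inverse : ∀ n → n < N → + suc n * v n ≅ + 1 mod M) where

      w-suc : ∀ n → n < N → + suc n * w (suc n) ≅ w n mod M
      w-suc n n<N = combination₁ (w n) (v-inverse n n<N) (lemma (+ suc n) (w n) (v n))
        where
        lemma : ∀ q w v → q * (w * v) - w ≡ w * (q * v - + 1)
        lemma = solve-∀

      !-inverse : ∀ n → n ≤ N → + (n !) * w n ≅ + 1 mod M
      !-inverse zero    _   = ≅-refl
      !-inverse (suc n) n<N = begin
        + (suc n !) * w (suc n)           ≡⟨ cong (_* w (suc n)) (ℤ.pos-* (suc n) (n !)) ⟩
        + suc n * + (n !) * w (suc n)     ≡⟨ reorder (+ suc n) (+ (n !)) (w (suc n)) ⟩
        + (n !) * (+ suc n * w (suc n))   ≈⟨ *-congˡ (+ (n !)) (w-suc n n<N) ⟩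
        + (n !) * w n                     ≈⟨ !-inverse n (ℕ.<⇒≤ n<N) ⟩
        + 1 ∎
        where
        open ≅-Reasoning M

        reorder : ∀ q f w → q * f * w ≡ f * (q * w)
        reorder = solve-∀

      -- By the derivation t d/dt: the coefficients of eᵗ eˣᵗ and of the exponential of (x + 1)t
      -- both satisfy (n + 1) cₙ₊₁ ≅ (x + 1) cₙ, and n + 1 is a unit in this range.
      conv-exp : ∀ x n → n ≤ N → conv w (expˣ x) n ≅ expˣ (x + + 1) n mod M
      conv-exp x zero    _   = ≅-refl
      conv-exp x (suc n) n<N = *-cancel-unit (+ suc n) (v n) (v-inverse n n<N) (begin
        + suc n * conv w (expˣ x) (suc n)
          ≡⟨ cong (_* conv w (expˣ x) (suc n)) (ℤ.+-identityʳ (+ suc n)) ⟨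
        (+ suc n + + 0) * conv w (expˣ x) (suc n)
          ≡⟨ conv-Leibniz w (expˣ x) (suc n) (+ 0) ⟩
        conv (λ i → + i * w i) (expˣ x) (suc n) + conv w (λ i → (+ i + + 0) * expˣ x i) (suc n)
          ≡⟨ cong₂ _+_ (conv-shiftˡ (λ i → + i * w i) (expˣ x) n refl)
                       (conv-shiftʳ w (λ i → (+ i + + 0) * expˣ x i) n refl) ⟩
        conv (λ i → + suc i * w (suc i)) (expˣ x) n + conv w (λ i → (+ suc i + + 0) * expˣ x (suc i)) n
          ≈⟨ +-cong (conv-cong n (λ i i≤n → w-suc i (ℕ.≤-<-trans i≤n n<N)) (λ _ _ → ≅-refl))
                    (conv-cong n (λ _ _ → ≅-refl) (λ i i≤n → derivative i (ℕ.≤-<-trans i≤n n<N))) ⟩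
        conv w (expˣ x) n + conv w (λ i → x * expˣ x i) n
          ≡⟨ cong (_+_ (conv w (expˣ x) n)) (conv-*ʳ w x (expˣ x) n) ⟩
        conv w (expˣ x) n + x * conv w (expˣ x) n
          ≡⟨ factor x (conv w (expˣ x) n) ⟩
        (x + + 1) * conv w (expˣ x) n
          ≈⟨ *-congˡ (x + + 1) (conv-exp x n (ℕ.<⇒≤ n<N)) ⟩
        (x + + 1) * expˣ (x + + 1) n
          ≈⟨ derivative′ (x + + 1) n n<N ⟨
        + suc n * expˣ (x + + 1) (suc n) ∎)
        where
        open ≅-Reasoning M

        derivative′ : ∀ x i → i < N → + suc i * expˣ x (suc i) ≅ x * expˣ x i mod M
        derivative′ x i i<N = combination₁ (x * x ^ i) (w-suc i i<N)
          (lemma (+ suc i) (w (suc i)) (w i) x (x ^ i))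
          where
          lemma : ∀ q w′ w x e → q * (w′ * (x * e)) - x * (w * e) ≡ x * e * (q * w′ - w)
          lemma = solve-∀

        derivative : ∀ i → i < N → (+ suc i + + 0) * expˣ x (suc i) ≅ x * expˣ x i mod M
        derivative i i<N = ≅-trans (≅-reflexive (cong (_* expˣ x (suc i)) (ℤ.+-identityʳ (+ suc i))))
          (derivative′ x i i<N)

        factor : ∀ x c → c + x * c ≡ (x + + 1) * c
        factor = solve-∀

      module _ (1<N : 1 < N) where

        -- (eᵗ + 1) annihilates F(x) + F(x + 1) - 2eˣᵗ, where F(x) = 2eˣᵗ / (eᵗ + 1).
        eulerSeries-shift : ∀ x n → n ≤ N →
                            eulerSeries x n + eulerSeries (x + + 1) n ≅ 2expˣ x n mod M
        eulerSeries-shift x n n≤N = congruent (≅0⇒∣ (≅-trans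
          -- The subtraction is written with a factor -1 so that `conv-*ʳ` applies to it.
          (≅-reflexive (cong (λ c → eulerSeries x n + eulerSeries (x + + 1) n + c)
                             (sym (ℤ.-1*i≡-i (2expˣ x n)))))
          (conv-cancel (v 1) (v-inverse 1 1<N)
            (λ i → eulerSeries x i + eulerSeries (x + + 1) i + -1ℤ * 2expˣ x i) n
            λ i i≤n → annihilated i (ℕ.≤-trans i≤n n≤N))))
          where
          open ≅-Reasoning M

          shifted : ∀ i → i ≤ N → conv w (2expˣ x) i ≅ 2expˣ (x + + 1) i mod M
          shifted i i≤N =
            ≅-trans (≅-reflexive (conv-*ʳ w (+ 2) (expˣ x) i)) (*-congˡ (+ 2) (conv-exp x i i≤N))

          cancel : ∀ a a′ → a + a′ + -1ℤ * (a′ + a) ≡ + 0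
          cancel = solve-∀

          annihilated : ∀ i → i ≤ N →
            conv exp+1 (λ i → eulerSeries x i + eulerSeries (x + + 1) i + -1ℤ * 2expˣ x i) i ≅ 0ℤ mod M
          annihilated i i≤N = begin
            conv exp+1 (λ i → eulerSeries x i + eulerSeries (x + + 1) i + -1ℤ * 2expˣ x i) i
              ≡⟨ conv-+ʳ exp+1 (λ i → eulerSeries x i + eulerSeries (x + + 1) i)
                         (λ i → -1ℤ * 2expˣ x i) i ⟩
            conv exp+1 (λ i → eulerSeries x i + eulerSeries (x + + 1) i) i
              + conv exp+1 (λ i → -1ℤ * 2expˣ x i) i
              ≡⟨ cong₂ _+_ (conv-+ʳ exp+1 (eulerSeries x) (eulerSeries (x + + 1)) i)
                           (conv-*ʳ exp+1 -1ℤ (2expˣ x) i) ⟩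
            conv exp+1 (eulerSeries x) i + conv exp+1 (eulerSeries (x + + 1)) i
              + -1ℤ * conv exp+1 (2expˣ x) i
              ≈⟨ +-cong (+-cong (conv-quotient (v 1) (v-inverse 1 1<N) (2expˣ x) i)
                                (conv-quotient (v 1) (v-inverse 1 1<N) (2expˣ (x + + 1)) i))
                        (*-congˡ -1ℤ (≅-trans (≅-reflexive (conv-exp+1 (2expˣ x) i))
                                              (+-cong (shifted i i≤N) (≅-refl {2expˣ x i})))) ⟩
            2expˣ x i + 2expˣ (x + + 1) i + -1ℤ * (2expˣ (x + + 1) i + 2expˣ x i)
              ≡⟨ cancel (2expˣ x i) (2expˣ (x + + 1) i) ⟩
            0ℤ ∎

        euler-shift : ∀ n → n ≤ N → ∀ x → euler n x + euler n (x + + 1) ≅ + 2 * x ^ n mod M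
        euler-shift n n≤N x = combination₂ (+ (n !)) (+ 2 * x ^ n)
          (eulerSeries-shift x n n≤N) (!-inverse n n≤N)
          (lemma (+ (n !)) (eulerSeries x n) (eulerSeries (x + + 1) n) (w n) (x ^ n))
          where
          lemma : ∀ f e e′ w z → f * e + f * e′ - + 2 * z
                ≡ f * (e + e′ - + 2 * (w * z)) + + 2 * z * (f * w - + 1)
          lemma = solve-∀

  -- Eₙ(1 + r) and Eₙ(-r) obey the same recurrence in r, so their difference
  -- changes sign with each step; over an odd period p it must vanish.
  shift-periodic⇒0 : ∀ {P} p m {h} → P ≡ + p → sgn p ≡ -1ℤ → + 2 * h ≅ + 1 mod P →
    (∀ x → (- x) ^ suc m ≡ x ^ suc m) → (e : ℤ → ℤ) →
    (∀ {x y} → x ≅ y mod P → e x ≅ e y mod P) →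
    (∀ x → e x + e (x + + 1) ≅ + 2 * x ^ suc m mod P) →
    e 0ℤ ≅ 0ℤ mod P
  shift-periodic⇒0 {P} p m {h} refl sgn-p 2h≅1 even e e-cong e-shift =
    -- e 0 + e 1 ≅ 0, since 0 has a positive exponent, and 2(e 1 - e 0) ≅ 0; together 4 e 0 ≅ 0,
    -- whence the two halvings.
    *-cancel-unit (+ 2) h 2h≅1 (*-cancel-unit (+ 2) h 2h≅1
      (combination₂ (+ 2) (- + 1) (e-shift 0ℤ) alternation (lemma (e 0ℤ) (e (+ 1)) (0ℤ ^ m))))
    where
    u s : ℕ → ℤ
    u r = e (+ suc r)
    s r = e (- + r)

    minus-suc : ∀ r → - (+ 1 + r) + + 1 ≡ - r
    minus-suc = solve-∀

    u-rec : ∀ r → r < p → u r + u (suc r) ≅ + 2 * (+ suc r) ^ suc m mod P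
    u-rec r _ = ≅-trans (≅-reflexive (cong (λ q → u r + e q) (ℤ.+-comm (+ 1) (+ suc r))))
                        (e-shift (+ suc r))

    s-rec : ∀ r → r < p → s r + s (suc r) ≅ + 2 * (+ suc r) ^ suc m mod P
    s-rec r _ = ≅-trans
      (≅-reflexive (trans (ℤ.+-comm (s r) (s (suc r)))
                          (cong (λ x → s (suc r) + e x) (sym (minus-suc (+ r))))))
      (≅-trans (e-shift (- + suc r)) (≅-reflexive (cong (+ 2 *_) (even (+ suc r)))))

    u-periodic : u p ≅ u 0 mod P
    u-periodic = e-cong (combination₁ (+ 1) (∣⇒≅0 (∣-refl {P})) (shape (+ p)))
      where
      shape : ∀ p → + 1 + p - + 1 ≡ + 1 * (p - + 0)
      shape = solve-∀

    s-periodic : s p ≅ s 0 mod P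
    s-periodic = e-cong (combination₁ (- + 1) (∣⇒≅0 (∣-refl {P})) (shape (+ p)))
      where
      shape : ∀ p → - p - + 0 ≡ - + 1 * (p - + 0)
      shape = solve-∀

    alternation : u 0 - s 0 ≅ -1ℤ * (u 0 - s 0) mod P
    alternation = ≅-trans (≅-sym (+-cong u-periodic (-‿cong s-periodic)))
      (≅-trans (difference-alternates {Y = u} {s} u-rec s-rec p ℕ.≤-refl)
        (≅-reflexive (cong (_* (u 0 - s 0)) sgn-p)))

    lemma : ∀ e₀ e₁ z → + 2 * (+ 2 * e₀) - + 2 * (+ 2 * + 0)
          ≡ + 2 * (e₀ + e₁ - + 2 * (+ 0 * z)) + - + 1 * (e₁ - e₀ - -1ℤ * (e₁ - e₀))
    lemma = solve-∀

  -- Fermat's little theorem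

  prime∤! : ∀ {p} → Prime p → ∀ k → k < p → p ℕ.∤ k !
  prime∤! {p} pr zero    0<p p∣1 with refl ← ℕ.∣1⇒≡1 p∣1 = ¬prime[1] pr
  prime∤! {p} pr (suc k) k<p p∣k! with euclidsLemma (suc k) (k !) pr p∣k!
  ... | inj₁ p∣1+k = ℕ.>⇒∤ k<p p∣1+k
  ... | inj₂ p∣k!′ = prime∤! pr k (ℕ.<-trans (ℕ.n<1+n k) k<p) p∣k!′

  prime∣C : ∀ {p} → Prime p → ∀ k → 0 < k → k < p → p ℕ.∣ p C k
  prime∣C {suc n} pr k@(suc k-1) _ k<p with euclidsLemma (p C k) (k ! ℕ.* (p ℕ.∸ k) !) pr p∣product
    where
    p : ℕ
    p = suc n

    instance _ = k ℕ.!* (p ℕ.∸ k) !≢0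

    p∣product : p ℕ.∣ (p C k) ℕ.* (k ! ℕ.* (p ℕ.∸ k) !)
    p∣product = subst (p ℕ.∣_)
      (sym (trans (cong (ℕ._* (k ! ℕ.* (p ℕ.∸ k) !)) (nCk≡n!/k![n-k]! (ℕ.<⇒≤ k<p)))
                  (ℕ.m/n*n≡m (subst (ℕ._∣ p !) (ℕ.*-comm ((p ℕ.∸ k) !) (k !))
                                    ([n∸k]!k!∣n! (ℕ.<⇒≤ k<p))))))
      (ℕ.m∣m*n (n !))
  ... | inj₁ p∣C = p∣C
  ... | inj₂ p∣k![p-k]! with euclidsLemma (k !) ((suc n ℕ.∸ k) !) pr p∣k![p-k]!
  ...   | inj₁ p∣k!     = contradiction p∣k! (prime∤! pr k k<p)
  ...   | inj₂ p∣[p-k]! = contradiction p∣[p-k]! (prime∤! pr (suc n ℕ.∸ k) (s≤s (ℕ.m∸n≤m n k-1)))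

  Exp≡^ : ∀ x n → x Exp.^ n ≡ x ^ n
  Exp≡^ x zero    = refl
  Exp≡^ x (suc n) = cong (x *_) (Exp≡^ x n)

  ∣-multiple : ∀ {k} n x → k ∣ + n → k ∣ n Multiple.× x
  ∣-multiple n x k∣n = subst (_ ∣_) (sym (multiple n)) (∣m⇒∣m*n x k∣n)
    where
    multiple : ∀ n → n Multiple.× x ≡ + n * x
    multiple zero    = refl
    multiple (suc n) = trans (cong (_+_ x) (multiple n)) (sym (ℤ.suc-* (+ n) x))

  ∣-sum : ∀ {k n} (t : Vector ℤ n) → (∀ i → k ∣ t i) → k ∣ sum t
  ∣-sum {n = zero}  t k∣t = divides 0ℤ refl
  ∣-sum {n = suc n} t k∣t = ∣m∣n⇒∣m+n (k∣t Fin.zero) (∣-sum (t ∘ Fin.suc) (k∣t ∘ Fin.suc))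

  freshman's-dream : ∀ {p} → Prime p → ∀ x y → (x + y) ^ p ≅ x ^ p + y ^ p mod + p
  freshman's-dream {p@(suc n)} pr x y = begin
    (x + y) ^ p                                ≡⟨ Exp≡^ (x + y) p ⟨
    (x + y) Exp.^ p                            ≡⟨ Binomial.theorem p x y ⟩
    t Fin.zero + sum (t ∘ Fin.suc)             ≡⟨ cong (_+_ (t Fin.zero)) (sum-init-last (t ∘ Fin.suc)) ⟩
    t Fin.zero + (sum middle + t (Fin.fromℕ p))
      ≈⟨ combination₁ (+ 1) (∣⇒≅0 (∣-sum middle p∣middle))
           (regroup (t Fin.zero) (sum middle) (t (Fin.fromℕ p))) ⟩
    t (Fin.fromℕ p) + t Fin.zero                   ≡⟨ cong₂ _+_ last-term first-term ⟩
    x ^ p + y ^ p                              ∎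
    where
    open ≅-Reasoning (+ p)

    t : Vector ℤ (suc p)
    t = Binomial.binomialTerm x y p

    middle : Vector ℤ n
    middle i = t (Fin.suc (inject₁ i))

    p∣middle : ∀ i → + p ∣ middle i
    p∣middle i = ∣-multiple (p C k) _ (∣ᵤ⇒∣ (prime∣C pr k (s≤s z≤n) (s≤s k<n)))
      where
      k : ℕ
      k = suc (toℕ (inject₁ i))

      k<n : toℕ (inject₁ i) < n
      k<n = subst (_< n) (sym (Fin.toℕ-inject₁ i)) (Fin.toℕ<n i)

    regroup : ∀ t₀ m t₁ → t₀ + (m + t₁) - (t₁ + t₀) ≡ + 1 * (m - + 0)
    regroup = solve-∀

    first-term : t Fin.zero ≡ y ^ p
    first-term = trans (ℤ.+-identityʳ _) (trans (ℤ.*-identityˡ _) (Exp≡^ y p))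

    last-term : t (Fin.fromℕ p) ≡ x ^ p
    last-term rewrite Fin.toℕ-fromℕ n | nCn≡1 (suc n) | ℕ.n∸n≡0 n =
      trans (ℤ.+-identityʳ _) (trans (ℤ.*-identityʳ _) (Exp≡^ x p))

  fermat : ∀ {p} → Prime p → ∀ k → (+ k) ^ p ≅ + k mod + p
  fermat {suc n} pr zero    = ≅-refl
  fermat {p}     pr (suc k) = ≅-trans (freshman's-dream pr (+ 1) (+ k))
    (+-cong (≅-reflexive (ℤ.^-zeroˡ p)) (fermat pr k))

  -- Units modulo prime powers

  record Unit (M x : ℤ) : Set where
    constructor unit
    field
      inverse   : ℤ
      *-inverse : x * inverse ≅ + 1 mod M

  open Unit public

  unit-* : Unit M x → Unit M y → Unit M (x * y)
  unit-* {M} {x} {y} (unit u xu≅1) (unit u′ yu′≅1) = unit (u * u′)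
    (≅-trans (≅-reflexive (lemma x y u u′)) (*-cong xu≅1 yu′≅1))
    where
    lemma : ∀ x y u u′ → x * y * (u * u′) ≡ x * u * (y * u′)
    lemma = solve-∀

  unit-weaken : M′ ∣ M → Unit M x → Unit M′ x
  unit-weaken M′∣M (unit u xu≅1) = unit u (≅-weaken M′∣M xu≅1)

  unit-factorˡ : ∀ x y → Unit M (x * y) → Unit M x
  unit-factorˡ x y (unit u xyu≅1) =
    unit (y * u) (≅-trans (≅-reflexive (sym (ℤ.*-assoc x y u))) xyu≅1)

  unit-factorʳ : ∀ x y → Unit M (x * y) → Unit M y
  unit-factorʳ x y unit-xy = unit-factorˡ y x (subst (Unit _) (ℤ.*-comm x y) unit-xy)

  -- The inverse is read off from 1 - (1 - x u)(1 - x u′), a multiple of x.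
  unit-modulus-* : ∀ {L} x → Unit M x → Unit L x → Unit (M * L) x
  unit-modulus-* {M} {L} x (unit u (congruent M∣)) (unit u′ (congruent L∣)) = unit (u + u′ - x * u * u′)
    (congruent (subst (M * L ∣_) (lemma x u u′) (∣m⇒∣-m (∣-∣-* M∣ L∣))))
    where
    lemma : ∀ x u u′ → - ((x * u - + 1) * (x * u′ - + 1)) ≡ x * (u + u′ - x * u * u′) - + 1
    lemma = solve-∀

  unit-modulus-^ : ∀ n x → Unit M x → Unit (M ^ n) x
  -- Modulo 1 any integer is an inverse.
  unit-modulus-^ zero    x _      = unit 0ℤ (congruent (divides (x * 0ℤ - + 1) (sym (ℤ.*-identityʳ _))))
  unit-modulus-^ (suc n) x unit-x = unit-modulus-* x unit-x (unit-modulus-^ n x unit-x)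

  prime⇒unit : ∀ {p} → Prime p → ∀ k → 0 < k → k < p → Unit (+ p) (+ k)
  prime⇒unit {p} pr k@(suc _) _ k<p with coprime-Bézout (prime⇒coprime pr k<p)
  ... | Bézout.+- x y eq = unit (- + y) (congruent (divides (- + x) (begin
    + k * - + y - + 1            ≡⟨ lemma (+ k) (+ y) ⟩
    - (+ 1 + + y * + k)          ≡⟨ cong (λ c → - (+ 1 + c)) (ℤ.pos-* y k) ⟨
    - + (1 ℕ.+ y ℕ.* k)          ≡⟨ cong (λ c → - + c) eq ⟩
    - + (x ℕ.* p)                ≡⟨ cong -_ (ℤ.pos-* x p) ⟩
    - (+ x * + p)                ≡⟨ ℤ.neg-distribˡ-* (+ x) (+ p) ⟩
    - + x * + p                  ∎)))
    where
    open ≡-Reasoning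

    lemma : ∀ k y → k * - y - + 1 ≡ - (+ 1 + y * k)
    lemma = solve-∀
  ... | Bézout.-+ x y eq = unit (+ y) (congruent (divides (+ x) (begin
    + k * + y - + 1              ≡⟨ cong (_- + 1) (ℤ.*-comm (+ k) (+ y)) ⟩
    + y * + k - + 1              ≡⟨ cong (_- + 1) (ℤ.pos-* y k) ⟨
    + (y ℕ.* k) - + 1            ≡⟨ cong (λ c → + c - + 1) eq ⟨
    + (1 ℕ.+ x ℕ.* p) - + 1      ≡⟨ lemma (+ (x ℕ.* p)) ⟩
    + (x ℕ.* p)                  ≡⟨ ℤ.pos-* x p ⟩
    + x * + p                    ∎)))
    where
    open ≡-Reasoning

    lemma : ∀ z → + 1 + z - + 1 ≡ z
    lemma = solve-∀

  inverses : ∀ {p} → Prime p → ∀ j → ∃[ v ] ∀ k → suc k < p → + suc k * v k ≅ + 1 mod (+ p) ^ j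
  inverses {p} pr j = v , v-inverse
    where
    units : ∀ k → suc k < p → Unit ((+ p) ^ j) (+ suc k)
    units k 1+k<p = unit-modulus-^ j (+ suc k) (prime⇒unit pr (suc k) (s≤s z≤n) 1+k<p)

    v : ℕ → ℤ
    v k with suc k ℕ.<? p
    ... | yes 1+k<p = inverse (units k 1+k<p)
    -- A default outside the range in which an inverse is claimed.
    ... | no  _     = 0ℤ

    v-inverse : ∀ k → suc k < p → + suc k * v k ≅ + 1 mod (+ p) ^ j
    v-inverse k 1+k<p with suc k ℕ.<? p
    ... | yes 1+k<p′ = *-inverse (units k 1+k<p′)
    ... | no  1+k≮p  = contradiction 1+k<p 1+k≮p

  -- Both sums against the closed form, over the integers

  even-or-odd : ∀ k → ∃[ i ] (k ≡ i ℕ.+ i ⊎ k ≡ suc (i ℕ.+ i))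
  even-or-odd zero    = 0 , inj₁ refl
  even-or-odd (suc k) with even-or-odd k
  ... | i , inj₁ refl = i , inj₂ refl
  ... | i , inj₂ refl = suc i , inj₁ (cong suc (sym (ℕ.+-suc i i)))

  -- With p = 4 + m the exponent is p - 3, which is even because 2 does not divide p.
  sgn-prime-3 : ∀ m → Prime (4 ℕ.+ m) → sgn (suc m) ≡ 1ℤ
  sgn-prime-3 m pr with even-or-odd m
  ... | i , inj₂ refl = trans (cong sgn (cong suc (sym (ℕ.+-suc i i))))
    (trans (ℤ.^-distribˡ-+-* -1ℤ (suc i) (suc i)) (sgn-square (suc i)))
  ... | i , inj₁ refl with prime⇒irreducible pr {2} (ℕ.divides (2 ℕ.+ i) (double i))
    where
    double : ∀ i → 4 ℕ.+ (i ℕ.+ i) ≡ (2 ℕ.+ i) ℕ.* 2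
    double i = trans (cong (λ j → 4 ℕ.+ (i ℕ.+ j)) (sym (ℕ.+-identityʳ i)))
                     (cong (4 ℕ.+_) (ℕ.*-comm 2 i))
  ...   | inj₁ ()
  ...   | inj₂ ()

  neg-^ : ∀ x k → (- x) ^ k ≡ sgn k * x ^ k
  neg-^ x zero    = refl
  neg-^ x (suc k) = trans (cong (- x *_) (neg-^ x k)) (lemma x (sgn k) (x ^ k))
    where
    lemma : ∀ x s y → - x * (s * y) ≡ -1ℤ * s * (x * y)
    lemma = solve-∀

  -- Multiply qᵖ ≅ q by v³: the left side becomes qᵖ⁻³ and the right side v².
  fermat-inverse-square : ∀ {m q v} → Prime (3 ℕ.+ m) → + q * v ≅ + 1 mod + (3 ℕ.+ m) →
                          (+ q) ^ m ≅ v * v mod + (3 ℕ.+ m)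
  fermat-inverse-square {m} {q} {v} pr qv≅1 = combination₂ (v * v * v)
    (v * v - (+ q) ^ m * (t * t + t + + 1)) (fermat pr q) qv≅1 (lemma (+ q) v ((+ q) ^ m))
    where
    t : ℤ
    t = + q * v

    lemma : ∀ q v z → let t = q * v in
      z - v * v ≡ v * v * v * (q * (q * (q * z)) - q)
        + (v * v - z * (t * t + t + + 1)) * (t - + 1)
    lemma = solve-∀

  module _ (v : ℕ → ℤ) where
    open RisingRatio v
    open EulerValues v

    closedForm : ℕ → ℕ → ℤ → ℤ
    closedForm m r a = sgn r * (a + + r) + (a + + r) * (a + + r) * (a + + r) * euler m a

    sums≅closedForm : ∀ {p} → Prime p → 3 < p →
      (∀ k → suc k < p → + suc k * v k ≅ + 1 mod (+ p) ^ 4) →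
      ∀ a r → + p ∣ a + + r → r < p →
      (∑ p (term a) ≅ closedForm (p ∸ 3) r a mod (+ p) ^ 4)
      × (∑ (suc r) (term a) ≅ closedForm (p ∸ 3) r a mod (+ p) ^ 4)
    sums≅closedForm {p} pr (s≤s (s≤s (s≤s (s≤s {n = m-1} z≤n)))) v-inverse a r p∣a+r (s≤s r≤n) =
      at-a (∑ p) (S.long≅closed (euler m) m even (euler-cong m) shift e-0 v-square r r≤n) ,
      at-a (∑ (suc r)) (S.short≅closed (euler m) m even (euler-cong m) shift e-0 v-square r r≤n)
      where
      -- The pattern on `3 < p` gives p = 4 + `m-1`, so m = p - 3 and n = p - 1; the form `suc m-1`
      -- is the positive exponent that `shift-periodic⇒0` asks for.
      m n : ℕ
      m = suc m-1
      n = suc (suc m)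

      sgn-m : sgn m ≡ 1ℤ
      sgn-m = sgn-prime-3 m-1 pr

      sgn-n : sgn n ≡ 1ℤ
      sgn-n = cong (λ s → -1ℤ * (-1ℤ * s)) sgn-m

      even : ∀ x → (- x) ^ m ≡ x ^ m
      even x = trans (neg-^ x m) (trans (cong (_* x ^ m) sgn-m) (ℤ.*-identityˡ (x ^ m)))

      module S = Sums n sgn-n v (λ k k<n → v-inverse k (s≤s k<n)) p∣a+r

      1<n : 1 < n
      1<n = s≤s (s≤s z≤n)

      shift : ∀ x → euler m x + euler m (x + + 1) ≅ + 2 * x ^ m mod + p
      shift = euler-shift S.v-inverseₚ 1<n m (ℕ.m≤n+m m 2)

      e-0 : euler m 0ℤ ≅ 0ℤ mod + p
      e-0 = shift-periodic⇒0 p m-1 refl (cong (-1ℤ *_) sgn-n) (S.v-inverseₚ 1 1<n) even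
                             (euler m) (euler-cong m) shift

      v-square : ∀ k → k < n → (+ suc k) ^ m ≅ v k * v k mod + p
      v-square k k<n = fermat-inverse-square pr (S.v-inverseₚ k k<n)

      -- `Sums` works at ε - r with ε = a + r, which equals a only propositionally.
      at-a : (Σ : (ℕ → ℤ) → ℤ) →
        Σ (term (a + + r - + r))
          ≅ S.closed (euler m) m even (euler-cong m) shift e-0 v-square r mod (+ p) ^ 4 →
        Σ (term a) ≅ closedForm m r a mod (+ p) ^ 4
      at-a Σ = subst
        (λ x → Σ (term x) ≅ sgn r * (a + + r) + (a + + r) * (a + + r) * (a + + r) * euler m x mod (+ p) ^ 4)
        (a+r-r≡a a (+ r))
        where
        a+r-r≡a : ∀ a r → a + r - r ≡ a
        a+r-r≡a = solve-∀

open Integers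
open import Defs

-- Residues of fractions

private variable
  p : ℕ
  M n d c n′ d′ c′ x : ℤ

-- `c` represents n / d modulo `M`. A relation, because numerator and denominator change under
-- normalisation while the residue does not.
record Fraction (M n d c : ℤ) : Set where
  constructor fraction
  field
    unit-denominator : Unit M d
    congruence       : n ≅ d ℤ.* c mod M

fraction-+ : Fraction M n d c → Fraction M n′ d′ c′ →
             Fraction M (d′ ℤ.* n ℤ.+ d ℤ.* n′) (d ℤ.* d′) (c ℤ.+ c′)
fraction-+ {d = d} {c} {d′ = d′} {c′} (fraction u n≅dc) (fraction u′ n′≅d′c′) = fraction (unit-* u u′)
  (≅-trans (+-cong (*-congˡ d′ n≅dc) (*-congˡ d n′≅d′c′)) (≅-reflexive (lemma d c d′ c′)))
  where
  lemma : ∀ d c d′ c′ → d′ ℤ.* (d ℤ.* c) ℤ.+ d ℤ.* (d′ ℤ.* c′) ≡ d ℤ.* d′ ℤ.* (c ℤ.+ c′)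
  lemma = solve-∀

fraction-* : Fraction M n d c → Fraction M n′ d′ c′ →
             Fraction M (n ℤ.* n′) (d ℤ.* d′) (c ℤ.* c′)
fraction-* {d = d} {c} {d′ = d′} {c′} (fraction u n≅dc) (fraction u′ n′≅d′c′) = fraction (unit-* u u′)
  (≅-trans (*-cong n≅dc n′≅d′c′) (≅-reflexive (lemma d c d′ c′)))
  where
  lemma : ∀ d c d′ c′ → d ℤ.* c ℤ.* (d′ ℤ.* c′) ≡ d ℤ.* d′ ℤ.* (c ℤ.* c′)
  lemma = solve-∀

fraction-neg : Fraction M n d c → Fraction M (ℤ.- n) d (ℤ.- c)
fraction-neg {d = d} {c} (fraction u n≅dc) =
  fraction u (≅-trans (-‿cong n≅dc) (≅-reflexive (ℤ.neg-distribʳ-* d c)))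

-- For the normalisation of rationals: the common factor `g` divides a unit, so it is a unit itself
-- and can be cancelled.
fraction-reduce : ∀ g → n′ ℤ.* g ≡ n → d′ ℤ.* g ≡ d → Fraction M n d c → Fraction M n′ d′ c
fraction-reduce {n′ = n′} {d′ = d′} {c = c} g refl refl (fraction u n≅dc) = fraction (unit-factorˡ d′ g u)
  (*-cancel-unit g (inverse unit-g) (*-inverse unit-g) (≅-trans (≅-reflexive (ℤ.*-comm g n′))
    (≅-trans n≅dc (≅-reflexive (lemma d′ g c)))))
  where
  unit-g = unit-factorʳ d′ g u

  lemma : ∀ d g c → d ℤ.* g ℤ.* c ≡ g ℤ.* (d ℤ.* c)
  lemma = solve-∀

fraction-integer : ∀ i → Fraction M i (+ 1) i
fraction-integer i = fraction (unit (+ 1) ≅-refl) (≅-reflexive (sym (ℤ.*-identityˡ i)))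

fraction-unit : ∀ d u → d ℤ.* u ≅ + 1 mod M → Fraction M (+ 1) d u
fraction-unit d u du≅1 = fraction (unit u du≅1) (≅-sym du≅1)

pos-^ : ∀ m n → + (m ℕ.^ n) ≡ (+ m) ℤ.^ n
pos-^ m zero    = refl
pos-^ m (suc n) = trans (ℤ.pos-* m (m ℕ.^ n)) (cong (+ m ℤ.*_) (pos-^ m n))

-- Sums over `Fin` unfold at the front, whereas `∑` grows at the end, as telescoping requires.
∑-cons : ∀ n f → ∑ (suc n) f ≡ f 0 ℤ.+ ∑ n (f ∘ suc)
∑-cons zero    f = ℤ.+-comm 0ℤ (f 0)
∑-cons (suc n) f = trans (cong (ℤ._+ f (suc n)) (∑-cons n f))
  (ℤ.+-assoc (f 0) (∑ n (f ∘ suc)) (f (suc n)))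

-- Stated for an arbitrary monoid, so that the operations of ℚₚ are not unfolded.
module _ (A : RawMonoid 0ℓ 0ℓ) (_∼_ : RawMonoid.Carrier A → ℤ → Set) (ε∼0 : RawMonoid.ε A ∼ 0ℤ)
         (∙∼+ : ∀ {x y c d} → x ∼ c → y ∼ d → RawMonoid._∙_ A x y ∼ (c ℤ.+ d)) where

  sum-related : ∀ n (f : ℕ → RawMonoid.Carrier A) g → (∀ k → k < n → f k ∼ g k) →
                RawMonoidDefs.sum A {n} (λ i → f (toℕ i)) ∼ ∑ n g
  sum-related zero    f g f∼g = ε∼0
  sum-related (suc n) f g f∼g = subst (RawMonoidDefs.sum A {suc n} (λ i → f (toℕ i)) ∼_)
    (sym (∑-cons n g))
    (∙∼+ (f∼g 0 (s≤s z≤n)) (sum-related n (f ∘ suc) (g ∘ suc) λ k k<n → f∼g (suc k) (s≤s k<n)))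

-- Rational numbers

infix 4 _⊢_↝_

record _⊢_↝_ (M : ℤ) (q : ℚ) (c : ℤ) : Set where
  constructor reduces
  field
    ↥/↧ : Fraction M (↥ q) (↧ q) c

↝-/ : ∀ i m .{{_ : NonZero m}} → Fraction M i (+ m) c → M ⊢ i ℚ./ m ↝ c
↝-/ i m i/m = reduces (fraction-reduce _ (ℚ.↥-/ i m) (ℚ.↧-/ i m) i/m)

↝-integer : ∀ i → M ⊢ i ℚ./ 1 ↝ i
↝-integer i = ↝-/ i 1 (fraction-integer i)

↝-+ : ∀ {q r} → M ⊢ q ↝ c → M ⊢ r ↝ c′ → M ⊢ q ℚ.+ r ↝ c ℤ.+ c′
↝-+ {q = q} {r} (reduces q↝c) (reduces r↝c′) = reduces (fraction-reduce _
  (trans (ℚ.↥-+ q r) (cong₂ ℤ._+_ (ℤ.*-comm (↥ q) (↧ r)) (ℤ.*-comm (↥ r) (↧ q))))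
  (ℚ.↧-+ q r) (fraction-+ q↝c r↝c′))

↝-* : ∀ {q r} → M ⊢ q ↝ c → M ⊢ r ↝ c′ → M ⊢ q ℚ.* r ↝ c ℤ.* c′
↝-* {q = q} {r} (reduces q↝c) (reduces r↝c′) =
  reduces (fraction-reduce _ (ℚ.↥-* q r) (ℚ.↧-* q r) (fraction-* q↝c r↝c′))

↝-neg : ∀ {q} → M ⊢ q ↝ c → M ⊢ ℚ.- q ↝ ℤ.- c
↝-neg {M} {c} {q} (reduces q↝c) = reduces
  (subst₂ (λ n d → Fraction M n d (ℤ.- c)) (sym (ℚ.↥-neg q)) (sym (ℚ.↧-neg q)) (fraction-neg q↝c))

-- Horner evaluation as a relation, which also records that every rational coefficient has a
-- denominator prime to `M`.
data Value (M x : ℤ) : Poly → ℤ → Set where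
  []  : Value M x [] 0ℤ
  _∷_ : ∀ {q f c y} → M ⊢ q ↝ c → Value M x f y → Value M x (q ∷ f) (c ℤ.+ x ℤ.* y)

module _ {A : Set} (φ : ℚ → A) (step : A → A → A) {z : A} (_∼_ : A → ℤ → Set) (z∼0 : z ∼ 0ℤ)
         (step∼ : ∀ {q v c y} → M ⊢ q ↝ c → v ∼ y → step (φ q) v ∼ (c ℤ.+ x ℤ.* y)) where

  -- Abstract in the target of the evaluation, like `sum-related` and for the same reason.
  horner-related : ∀ {f y} → Value M x f y → foldr (λ c v → step (φ c) v) z f ∼ y
  horner-related []      = z∼0
  horner-related (q ∷ u) = step∼ q (horner-related u)

module _ {x : ℤ} where

  value-+ : ∀ {f g y z} → Value M x f y → Value M x g z → Value M x (f +ᵖ g) (y ℤ.+ z)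
  value-+ [] v = subst (Value _ x _) (sym (ℤ.+-identityˡ _)) v
  value-+ (q ∷ u) [] = subst (Value _ x _) (sym (ℤ.+-identityʳ _)) (q ∷ u)
  value-+ (_∷_ {c = c} {y} q u) (_∷_ {c = c′} {y′} r v) =
    subst (Value _ x _) (lemma c c′ x y y′) (↝-+ q r ∷ value-+ u v)
    where
    lemma : ∀ c c′ x y y′ → c ℤ.+ c′ ℤ.+ x ℤ.* (y ℤ.+ y′) ≡ c ℤ.+ x ℤ.* y ℤ.+ (c′ ℤ.+ x ℤ.* y′)
    lemma = solve-∀

  value-· : ∀ {q f y} → M ⊢ q ↝ c → Value M x f y → Value M x (q · f) (c ℤ.* y)
  value-· {c = c} q [] = subst (Value _ x _) (sym (ℤ.*-zeroʳ c)) []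
  value-· {c = c} q (_∷_ {c = c′} {y} r u) =
    subst (Value _ x _) (lemma c c′ x y) (↝-* q r ∷ value-· q u)
    where
    lemma : ∀ c c′ x y → c ℤ.* c′ ℤ.+ x ℤ.* (c ℤ.* y) ≡ c ℤ.* (c′ ℤ.+ x ℤ.* y)
    lemma = solve-∀

  value-x^ : ∀ n → Value M x (x^ n) (x ℤ.^ n)
  value-x^ zero    = subst (Value _ x _) (lemma x) (reduces (fraction-integer (+ 1)) ∷ [])
    where
    lemma : ∀ x → + 1 ℤ.+ x ℤ.* + 0 ≡ + 1
    lemma = solve-∀
  value-x^ (suc n) = subst (Value _ x _) (ℤ.+-identityˡ _) (reduces (fraction-integer 0ℤ) ∷ value-x^ n)

  -- The two divisions recurse in step. Coefficient n depends only on the coefficients up to n of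
  -- both series; this bound matters because 1 / i! has a residue only while i! is a unit.
  value-divide : ∀ {A B h b a} .{{_ : ℚ.NonZero (B 0)}} n → M ⊢ ℚ.1/ B 0 ↝ h →
    (∀ i → i ≤ n → M ⊢ B i ↝ b i) → (∀ i → i ≤ n → Value M x (A i) (a i)) →
    Value M x (divide A B n) (quotient h b a n)
  value-divide zero    1/B₀ B↝b A↝a = value-· 1/B₀ (A↝a 0 z≤n)
  value-divide (suc n) 1/B₀ B↝b A↝a = value-divide n 1/B₀ (λ i i≤n → B↝b i (ℕ.m≤n⇒m≤1+n i≤n))
    λ i i≤n → value-+ (A↝a (suc i) (s≤s i≤n))
      (value-· (↝-neg (B↝b (suc i) (s≤s i≤n))) (value-· 1/B₀ (A↝a 0 z≤n)))

  module _ (v : ℕ → ℤ) {N : ℕ} (v-inverse : ∀ n → n < N → + suc n ℤ.* v n ≅ + 1 mod M)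
           (1<N : 1 < N) where
    open EulerValues v

    value-E : ∀ n → n ≤ N → Value M x (E n) (euler n x)
    value-E n n≤N = value-· (↝-integer (+ (n !))) (value-divide n
      -- The constant term of eᵗ + 1 evaluates to 2, so its reciprocal computes to 1/2.
      (reduces (fraction-unit (+ 2) (v 1) (v-inverse 1 1<N)))
      (λ { zero    _   → ↝-+ {q = 1/! 0} {1ℚ} (↝-1/! 0 z≤n) (reduces (fraction-integer (+ 1)))
         ; (suc i) i<n → ↝-1/! (suc i) (ℕ.≤-trans i<n n≤N) })
      (λ i i≤n → value-· (↝-integer (+ 2)) (value-· (↝-1/! i (ℕ.≤-trans i≤n n≤N)) (value-x^ i))))
      where
      ↝-1/! : ∀ i → i ≤ N → M ⊢ 1/! i ↝ w i
      ↝-1/! i i≤N = ↝-/ (+ 1) (i !) {{i ℕ.!≢0}}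
        (fraction-unit (+ (i !)) (w i) (!-inverse v-inverse i i≤N))

-- p-adic numbers

infix 4 _⇝_[mod-p^_]

-- Only the approximation at level `N` enters, which turns p-adic congruences into integer ones.
record _⇝_[mod-p^_] {p} (x : ℚₚ p) (c : ℤ) (N : ℕ) : Set where
  constructor residue
  field
    numerator/denominator : Fraction (+ (p ℕ.^ N)) (approx (ℚₚ.numerator x) N) (+ ℚₚ.denominator x) c

module _ {N : ℕ} where

  ⇝-ι : (x : ℤₚ p) → ι x ⇝ approx x N [mod-p^ N ]
  ⇝-ι x = residue (fraction-integer (approx x N))

  ⇝-⊕ : {x y : ℚₚ p} → x ⇝ c [mod-p^ N ] → y ⇝ c′ [mod-p^ N ] → x ⊕ y ⇝ c ℤ.+ c′ [mod-p^ N ]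
  ⇝-⊕ {p} {c} {c′} {x / m} {y / n} (residue x⇝c) (residue y⇝c′) = residue
    (subst (λ d → Fraction (+ (p ℕ.^ N)) (+ n ℤ.* approx x N ℤ.+ + m ℤ.* approx y N) d (c ℤ.+ c′))
      (sym (ℤ.pos-* m n)) (fraction-+ x⇝c y⇝c′))

  ⇝-⊗ : {x y : ℚₚ p} → x ⇝ c [mod-p^ N ] → y ⇝ c′ [mod-p^ N ] → x ⊗ y ⇝ c ℤ.* c′ [mod-p^ N ]
  ⇝-⊗ {p} {c} {c′} {x / m} {y / n} (residue x⇝c) (residue y⇝c′) = residue
    (subst (λ d → Fraction (+ (p ℕ.^ N)) (approx x N ℤ.* approx y N) d (c ℤ.* c′))
      (sym (ℤ.pos-* m n)) (fraction-* x⇝c y⇝c′))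

  ⇝-∑ : ∀ n (f : ℕ → ℚₚ p) g → (∀ k → k < n → f k ⇝ g k [mod-p^ N ]) → ∑[ n ] f ⇝ ∑ n g [mod-p^ N ]
  ⇝-∑ {p} = sum-related (RawRing.+-rawMonoid (ℚₚ-rawRing p)) (_⇝_[mod-p^ N ])
    (⇝-ι (fromℕ 0)) (λ {x} {y} → ⇝-⊕ {x = x} {y})

  ⇝-eval : ∀ {f} (α : ℤₚ p) → Value (+ (p ℕ.^ N)) (approx α N) f c → eval f (ι α) ⇝ c [mod-p^ N ]
  ⇝-eval {p} α = horner-related fromℚ (λ a v → a ⊕ ι α ⊗ v) (_⇝_[mod-p^ N ]) (⇝-ι (fromℕ 0))
    (λ {q} {v} (reduces q↝c) v⇝y → ⇝-⊕ {x = fromℚ q} {ι α ⊗ v} (residue q↝c)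
      (⇝-⊗ {x = ι α} {v} (⇝-ι α) v⇝y))

coherent-+ : (x : ℤₚ p) → ∀ k n → approx x (k ℕ.+ n) ≅ approx x n mod + (p ℕ.^ n)
coherent-+ x zero    n = ≅-refl
coherent-+ {p} x (suc k) n = ≅-trans
  (≅-weaken (divides (+ (p ℕ.^ k))
              (trans (cong +_ (ℕ.^-distribˡ-+-* p k n)) (ℤ.pos-* (p ℕ.^ k) (p ℕ.^ n))))
    (congruent (coherent x (k ℕ.+ n))))
  (coherent-+ x k n)

module _ (pr : Prime p) where
  private instance _ = prime⇒nonZero pr

  -- Division by pᴺ costs N digits of precision, so level n of the quotient is read off from level n
  -- + N of `x`.
  divide-by-p^ : ∀ N (x : ℤₚ p) → + (p ℕ.^ N) ∣ approx x N →
                 ∃[ y ] ∀ n → approx x (n ℕ.+ N) ≡ approx {p} y n ℤ.* + (p ℕ.^ N)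
  divide-by-p^ N x p^N∣x = mkℤₚ y y-coherent , y*p^N
    where
    instance _ = ℕ.m^n≢0 p N

    p^N∣ : ∀ n → + (p ℕ.^ N) ∣ approx x (n ℕ.+ N)
    p^N∣ n = ≅0⇒∣ (≅-trans (coherent-+ x n N) (∣⇒≅0 p^N∣x))

    y : ℕ → ℤ
    y n = _∣_.quotient (p^N∣ n)

    y*p^N : ∀ n → approx x (n ℕ.+ N) ≡ y n ℤ.* + (p ℕ.^ N)
    y*p^N n = _∣_.equality (p^N∣ n)

    distribute : ∀ y y′ q → y′ ℤ.* q ℤ.- y ℤ.* q ≡ (y′ ℤ.- y) ℤ.* q
    distribute = solve-∀

    y-coherent : ∀ n → + (p ℕ.^ n) ∣ y (suc n) ℤ.- y n
    y-coherent n = *-cancelʳ-∣ (+ (p ℕ.^ N)) (subst₂ _∣_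
      (trans (cong +_ (ℕ.^-distribˡ-+-* p n N)) (ℤ.pos-* (p ℕ.^ n) (p ℕ.^ N)))
      (trans (cong₂ ℤ._-_ (y*p^N (suc n)) (y*p^N n)) (distribute (y n) (y (suc n)) (+ (p ℕ.^ N))))
      (coherent x (n ℕ.+ N)))

  -- The inverses at the various levels are chosen independently; uniqueness of inverses makes them
  -- coherent.
  inverse-ℤₚ : ∀ d → Unit (+ p) d → ∃[ u ] ∀ n → d ℤ.* approx {p} u n ≅ + 1 mod + (p ℕ.^ n)
  inverse-ℤₚ d unit-d = mkℤₚ u u-coherent , d*u≅1
    where
    units : ∀ n → Unit (+ (p ℕ.^ n)) d
    units n = subst (λ M → Unit M d) (sym (pos-^ p n)) (unit-modulus-^ n d unit-d)

    u : ℕ → ℤ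
    u n = inverse (units n)

    d*u≅1 : ∀ n → d ℤ.* u n ≅ + 1 mod + (p ℕ.^ n)
    d*u≅1 n = *-inverse (units n)

    u-coherent : ∀ n → + (p ℕ.^ n) ∣ u (suc n) ℤ.- u n
    u-coherent n = ∣-difference (*-cancel-unit d (u n) (d*u≅1 n)
      (≅-trans (≅-weaken (divides (+ p) (ℤ.pos-* p (p ℕ.^ n))) (d*u≅1 (suc n))) (≅-sym (d*u≅1 n))))

  -- The witness is x / pᴺ times the inverse of `d`; the factor `d` is the denominator that
  -- cross-multiplication in `_≋_` moves to this side.
  divisible : ∀ N d → Unit (+ p) d → (x : ℤₚ p) → + (p ℕ.^ N) ∣ approx x N →
              ∃[ z ] x ≈ fromℤ d * (fromℕ (p ℕ.^ N) * z)
  divisible N d unit-d x p^N∣x = u * y , λ n → ∣-difference (division n)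
    where
    y u : ℤₚ p
    y = proj₁ (divide-by-p^ N x p^N∣x)
    u = proj₁ (inverse-ℤₚ d unit-d)

    lemma : ∀ y q d u → y ℤ.* q ℤ.- d ℤ.* (q ℤ.* (u ℤ.* y)) ≡ ℤ.- (y ℤ.* q) ℤ.* (d ℤ.* u ℤ.- + 1)
    lemma = solve-∀

    division : ∀ n → approx x n ≅ d ℤ.* (+ (p ℕ.^ N) ℤ.* (approx u n ℤ.* approx y n)) mod + (p ℕ.^ n)
    division n = begin
      approx x n                 ≈⟨ coherent-+ x N n ⟨
      approx x (N ℕ.+ n)         ≡⟨ cong (approx x) (ℕ.+-comm N n) ⟩
      approx x (n ℕ.+ N)         ≡⟨ proj₂ (divide-by-p^ N x p^N∣x) n ⟩
      approx y n ℤ.* + (p ℕ.^ N) ≈⟨ combination₁ (ℤ.- (approx y n ℤ.* + (p ℕ.^ N)))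
                                      (proj₂ (inverse-ℤₚ d unit-d) n)
                                      (lemma (approx y n) (+ (p ℕ.^ N)) d (approx u n)) ⟩
      d ℤ.* (+ (p ℕ.^ N) ℤ.* (approx u n ℤ.* approx y n)) ∎
      where open ≅-Reasoning (+ (p ℕ.^ n))

  -- The way back from residues to ℚₚ. The exponent is positive so that a unit modulo that power of
  -- p is also a unit modulo p.
  ⇝⇒≡ : ∀ {N} {x y : ℚₚ p} → x ⇝ c [mod-p^ suc N ] → y ⇝ c′ [mod-p^ suc N ] →
        c ≅ c′ mod + (p ℕ.^ suc N) → x ≡ y [mod-p^ suc N ]
  ⇝⇒≡ {c} {c′} {N} {x / m} {y / n}
      (residue (fraction unit-m x≅mc)) (residue (fraction unit-n y≅nc′)) c≅c′ =
    proj₁ division , λ i → subst (λ e → + (p ℕ.^ i) ∣ e ℤ.- approx multiple i)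
      -- The factor 1 is the denominator of `ι`.
      (sym (ℤ.*-identityˡ (approx difference i))) (proj₂ division i)
    where
    open ≅-Reasoning (+ (p ℕ.^ suc N))

    difference : ℤₚ p
    difference = fromℕ n * x + fromℕ m * - y

    unit-mn : Unit (+ p) (+ (m ℕ.* n))
    unit-mn = unit-weaken
      (divides (+ (p ℕ.^ N)) (trans (ℤ.pos-* p (p ℕ.^ N)) (ℤ.*-comm (+ p) (+ (p ℕ.^ N)))))
      (subst (Unit _) (sym (ℤ.pos-* m n)) (unit-* unit-m unit-n))

    lemma : ∀ m n c c′ → n ℤ.* (m ℤ.* c) ℤ.+ m ℤ.* ℤ.- (n ℤ.* c′) ℤ.- + 0 ≡ m ℤ.* n ℤ.* (c ℤ.- c′)
    lemma = solve-∀

    division : ∃[ z ] difference ≈ fromℤ (+ (m ℕ.* n)) * (fromℕ (p ℕ.^ suc N) * z)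
    division = divisible (suc N) (+ (m ℕ.* n)) unit-mn difference (≅0⇒∣ (begin
      + n ℤ.* approx x (suc N) ℤ.+ + m ℤ.* ℤ.- approx y (suc N)
        ≈⟨ +-cong (*-congˡ (+ n) x≅mc) (*-congˡ (+ m) (-‿cong y≅nc′)) ⟩
      + n ℤ.* (+ m ℤ.* c) ℤ.+ + m ℤ.* ℤ.- (+ n ℤ.* c′)
        ≈⟨ combination₁ (+ m ℤ.* + n) c≅c′ (lemma (+ m) (+ n) c c′) ⟩
      0ℤ ∎))

    multiple : ℤₚ p
    multiple = fromℤ (+ (m ℕ.* n)) * (fromℕ (p ℕ.^ suc N) * proj₁ division)

-- The summands

pochhammerℤ : ℤ → ℕ → ℤ
pochhammerℤ = pochhammer (RawRing.rawSemiring ℤ.+-*-rawRing)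

-- `pochhammer` splits off its first factor, `ρ` its last.
pochhammerℤ-suc : ∀ a k → pochhammerℤ a (suc k) ≡ pochhammerℤ a k ℤ.* (a ℤ.+ + k)
pochhammerℤ-suc a zero    = lemma a
  where
  lemma : ∀ a → a ℤ.* + 1 ≡ + 1 ℤ.* (a ℤ.+ + 0)
  lemma = solve-∀
pochhammerℤ-suc a (suc k) = trans (cong (a ℤ.*_) (pochhammerℤ-suc (a ℤ.+ + 1) k))
  (lemma a (pochhammerℤ (a ℤ.+ + 1) k) (+ k))
  where
  lemma : ∀ a P k → a ℤ.* (P ℤ.* (a ℤ.+ + 1 ℤ.+ k)) ≡ a ℤ.* P ℤ.* (a ℤ.+ (+ 1 ℤ.+ k))
  lemma = solve-∀

-- Applied at m = 0, but the recursion of `pochhammer` raises its base, so the induction needs every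
-- base.
!*pochhammer : ∀ m k → m ! ℕ.* pochhammer ℕ.+-*-rawSemiring (suc m) k ≡ (m ℕ.+ k) !
!*pochhammer m zero    = trans (ℕ.*-identityʳ (m !)) (cong _! (sym (ℕ.+-identityʳ m)))
!*pochhammer m (suc k) = begin
  m ! ℕ.* (suc m ℕ.* pochhammer ℕ.+-*-rawSemiring (suc m ℕ.+ 1) k)
    ≡⟨ ℕ.*-assoc (m !) (suc m) _ ⟨
  m ! ℕ.* suc m ℕ.* pochhammer ℕ.+-*-rawSemiring (suc m ℕ.+ 1) k
    ≡⟨ cong₂ (λ c x → c ℕ.* pochhammer ℕ.+-*-rawSemiring x k)
             (ℕ.*-comm (m !) (suc m)) (ℕ.+-comm (suc m) 1) ⟩
  suc m ! ℕ.* pochhammer ℕ.+-*-rawSemiring (suc (suc m)) k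
    ≡⟨ !*pochhammer (suc m) k ⟩
  (suc m ℕ.+ k) !
    ≡⟨ cong _! (ℕ.+-suc m k) ⟨
  (m ℕ.+ suc k) ! ∎
  where open ≡-Reasoning

pochhammer-1 : ∀ k → pochhammer ℕ.+-*-rawSemiring 1 k ≡ k !
pochhammer-1 k = trans (sym (ℕ.*-identityˡ _)) (!*pochhammer 0 k)

approx-pochhammer : ∀ (α : ℤₚ p) N k →
  approx (pochhammer (RawRing.rawSemiring (ℤₚ-rawRing p)) α k) N ≡ pochhammerℤ (approx α N) k
approx-pochhammer α N zero    = refl
approx-pochhammer α N (suc k) = cong (approx α N ℤ.*_) (approx-pochhammer (α + fromℕ 1) N k)

approx-^ : ∀ (x : ℤₚ p) N k → approx (x ^ k) N ≡ approx x N ℤ.^ k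
approx-^ x N zero    = refl
approx-^ x N (suc k) = cong (approx x N ℤ.*_) (approx-^ x N k)

module _ (v : ℕ → ℤ) {m : ℕ} (v-inverse : ∀ n → n < m → + suc n ℤ.* v n ≅ + 1 mod M) where
  open RisingRatio v
  open EulerValues v using (w; !-inverse)

  !*ρ : ∀ a k → k ≤ m → pochhammerℤ a k ≅ + (k !) ℤ.* ρ a k mod M
  !*ρ a zero    _   = ≅-refl
  !*ρ a (suc k) k<m = begin
    pochhammerℤ a (suc k)                           ≡⟨ pochhammerℤ-suc a k ⟩
    pochhammerℤ a k ℤ.* (a ℤ.+ + k)                 ≈⟨ *-congʳ (a ℤ.+ + k) (!*ρ a k (ℕ.<⇒≤ k<m)) ⟩
    + (k !) ℤ.* ρ a k ℤ.* (a ℤ.+ + k)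
      ≈⟨ combination₁ (ℤ.- (+ (k !) ℤ.* ρ a k ℤ.* (a ℤ.+ + k))) (v-inverse k k<m)
           (lemma (+ (k !)) (ρ a k) (a ℤ.+ + k) (+ suc k) (v k)) ⟩
    + suc k ℤ.* + (k !) ℤ.* ρ a (suc k)             ≡⟨ cong (ℤ._* ρ a (suc k)) (ℤ.pos-* (suc k) (k !)) ⟨
    + (suc k !) ℤ.* ρ a (suc k) ∎
    where
    open ≅-Reasoning M

    lemma : ∀ f ρ x q v → f ℤ.* ρ ℤ.* x ℤ.- q ℤ.* f ℤ.* (x ℤ.* v ℤ.* ρ)
                        ≡ ℤ.- (f ℤ.* ρ ℤ.* x) ℤ.* (q ℤ.* v ℤ.- + 1)
    lemma = solve-∀

module _ {N : ℕ} (v : ℕ → ℤ) {m : ℕ}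
         (v-inverse : ∀ n → n < m → + suc n ℤ.* v n ≅ + 1 mod + (p ℕ.^ N)) where
  open RisingRatio v
  open EulerValues v using (w; !-inverse)

  ⇝-summand : ∀ (α : ℤₚ p) k → k ≤ m → summand α k ⇝ term (approx α N) k [mod-p^ N ]
  ⇝-summand α k k≤m =
    residue (subst₂ (λ n d → Fraction (+ (p ℕ.^ N)) n d (term a k)) numerator denominator
      (subst (Fraction (+ (p ℕ.^ N)) (κ ℤ.* pochhammerℤ a k ℤ.^ 3) (+ 1 ℤ.* (+ (k !)) ℤ.^ 3))
        (cong (κ ℤ.*_) (cube (ρ a k)))
        (fraction-* (fraction-integer κ)
          (fraction-* ratio (fraction-* ratio (fraction-* ratio (fraction-integer 1ℤ)))))))
    where
    a κ : ℤ
    a = approx α N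
    κ = sgn k ℤ.* (+ 2 ℤ.* + k ℤ.+ a)

    ratio : Fraction (+ (p ℕ.^ N)) (pochhammerℤ a k) (+ (k !)) (ρ a k)
    ratio = fraction (unit (w k) (!-inverse v-inverse k k≤m)) (!*ρ v v-inverse a k k≤m)

    cube : ∀ x → x ℤ.* (x ℤ.* (x ℤ.* + 1)) ≡ x ℤ.* x ℤ.* x
    cube = solve-∀

    numerator : κ ℤ.* pochhammerℤ a k ℤ.^ 3 ≡ approx (ℚₚ.numerator (summand α k)) N
    numerator = cong₂ (λ s P → s ℤ.* (+ 2 ℤ.* + k ℤ.+ a) ℤ.* P ℤ.^ 3)
      (sym (approx-^ (- fromℕ 1) N k)) (sym (approx-pochhammer α N k))

    1ₖ : ℕ
    1ₖ = pochhammer ℕ.+-*-rawSemiring 1 k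

    denominator : + 1 ℤ.* (+ (k !)) ℤ.^ 3 ≡ + (1 ℕ.* 1ₖ ℕ.^ 3)
    denominator = trans (cong (λ d → + 1 ℤ.* (+ d) ℤ.^ 3) (sym (pochhammer-1 k)))
      (trans (cong (+ 1 ℤ.*_) (sym (pos-^ 1ₖ 3))) (sym (ℤ.pos-* 1 (1ₖ ℕ.^ 3))))

-- From the integers back to the p-adic congruences

module _ {p : ℕ} {{pr : Prime p}} where

  ⟨⟩<p : ∀ (α : ℤₚ p) → ⟨ α ⟩ < p
  ⟨⟩<p α = ℤ.n%ℕd<d (approx α 1) p
    where instance _ = prime⇒nonZero pr

  -- `⟨_⟩` reads level 1 of its argument while the sums use level 4; coherence links the two.
  p∣α+⟨-α⟩ : ∀ (α : ℤₚ p) → + p ∣ approx α 4 ℤ.+ + ⟨ - α ⟩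
  p∣α+⟨-α⟩ α = ≅0⇒∣ (combination₂ (+ 1) (+ 1) α₄≅α₁ α₁≅-r
    (lemma (approx α 4) (approx α 1) (+ ⟨ - α ⟩)))
    where
    instance _ = prime⇒nonZero pr

    α₄≅α₁ : approx α 4 ≅ approx α 1 mod + p
    α₄≅α₁ = subst (λ q → approx α 4 ≅ approx α 1 mod + q) (ℕ.*-identityʳ p) (coherent-+ α 3 1)

    remainder : ∀ x r q → ℤ.- x ≡ r ℤ.+ q → x ℤ.- ℤ.- r ≡ ℤ.- q
    remainder x r q eq =
      trans (cong (ℤ._- ℤ.- r) (trans (sym (ℤ.neg-involutive x)) (cong ℤ.-_ eq))) (cancel r q)
      where
      cancel : ∀ r q → ℤ.- (r ℤ.+ q) ℤ.- ℤ.- r ≡ ℤ.- q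
      cancel = solve-∀

    k : ℤ
    k = approx (- α) 1 ℤ./ℕ p

    α₁≅-r : approx α 1 ≅ ℤ.- + ⟨ - α ⟩ mod + p
    α₁≅-r = congruent (subst (+ p ∣_)
      (sym (remainder (approx α 1) (+ ⟨ - α ⟩) (k ℤ.* + p) (ℤ.a≡a%ℕn+[a/ℕn]*n (approx (- α) 1) p)))
      (∣m⇒∣-m (∣n⇒∣m*n k (∣-refl {+ p}))))

    lemma : ∀ x y r → x ℤ.+ r ℤ.- + 0 ≡ + 1 ℤ.* (x ℤ.- y) ℤ.+ + 1 ℤ.* (y ℤ.- ℤ.- r)
    lemma = solve-∀

theorem1p5 :
    ∀ {p : ℕ} {{_ : Prime p}} → 3 < p → (α : ℤₚ p) →
    let r   = ⟨ - α ⟩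
        rhs = ι ((- fromℕ 1) ^ r * (α + fromℕ r))
              ⊕ ι ((α + fromℕ r) ^ 3) ⊗ eval (E (p ∸ 3)) (ι α)
    in
      (∑[ p ] (summand α) ≡ rhs [mod-p^ 4 ])
      × (∑[ suc r ] (summand α) ≡ rhs [mod-p^ 4 ])
theorem1p5 {p} {{pr}} 3<p α =
  ⇝⇒≡ pr {N = 3} {x = ∑[ p ] (summand α)} {y = rhs} (sum p ℕ.≤-refl) rhs⇝ (mod-M (proj₁ sums)) ,
  ⇝⇒≡ pr {N = 3} {x = ∑[ suc r ] (summand α)} {y = rhs} (sum (suc r) r<p) rhs⇝ (mod-M (proj₂ sums))
  where
  r : ℕ
  r = ⟨ - α ⟩

  r<p : r < p
  r<p = ⟨⟩<p (- α)

  rhs : ℚₚ p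
  rhs = ι ((- fromℕ 1) ^ r * (α + fromℕ r)) ⊕ ι ((α + fromℕ r) ^ 3) ⊗ eval (E (p ∸ 3)) (ι α)

  a ε : ℤ
  a = approx α 4
  ε = a ℤ.+ + r

  v : ℕ → ℤ
  v = proj₁ (inverses pr 4)

  open RisingRatio v
  open EulerValues v

  mod-M : ∀ {x y} → x ≅ y mod (+ p) ℤ.^ 4 → x ≅ y mod + (p ℕ.^ 4)
  mod-M {x} {y} = subst (x ≅ y mod_) (sym (pos-^ p 4))

  p-1 : ℕ
  p-1 = ℕ.pred p

  1+[p-1]≤p : suc p-1 ≤ p
  1+[p-1]≤p = ℕ.m≤pred[n]⇒suc[m]≤n {{prime⇒nonZero pr}} ℕ.≤-refl

  v-inverse : ∀ k → k < p-1 → + suc k ℤ.* v k ≅ + 1 mod + (p ℕ.^ 4)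
  v-inverse k k<p-1 = mod-M (proj₂ (inverses pr 4) k (ℕ.≤-trans (s≤s k<p-1) 1+[p-1]≤p))

  sums : (∑ p (term a) ≅ closedForm v (p ∸ 3) r a mod (+ p) ℤ.^ 4)
       × (∑ (suc r) (term a) ≅ closedForm v (p ∸ 3) r a mod (+ p) ℤ.^ 4)
  sums = sums≅closedForm v pr 3<p (proj₂ (inverses pr 4)) a r (p∣α+⟨-α⟩ α) r<p

  sum : ∀ j → j ≤ p → ∑[ j ] (summand α) ⇝ ∑ j (term a) [mod-p^ 4 ]
  sum j j≤p = ⇝-∑ j (summand α) (term a) λ k k<j →
    ⇝-summand v v-inverse α k (ℕ.suc[m]≤n⇒m≤pred[n] (ℕ.≤-trans k<j j≤p))

  linear : ι ((- fromℕ 1) ^ r * (α + fromℕ r)) ⇝ sgn r ℤ.* ε [mod-p^ 4 ]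
  linear = subst (λ s → ι ((- fromℕ 1) ^ r * (α + fromℕ r)) ⇝ s ℤ.* ε [mod-p^ 4 ])
    (approx-^ (- fromℕ 1) 4 r) (⇝-ι _)

  cubic : ι ((α + fromℕ r) ^ 3) ⇝ ε ℤ.* ε ℤ.* ε [mod-p^ 4 ]
  cubic = subst (ι ((α + fromℕ r) ^ 3) ⇝_[mod-p^ 4 ]) (cube ε) (⇝-ι _)
    where
    cube : ∀ x → x ℤ.* (x ℤ.* (x ℤ.* + 1)) ≡ x ℤ.* x ℤ.* x
    cube = solve-∀

  rhs⇝ : rhs ⇝ closedForm v (p ∸ 3) r a [mod-p^ 4 ]
  rhs⇝ = ⇝-⊕ {x = ι ((- fromℕ 1) ^ r * (α + fromℕ r))}
             {ι ((α + fromℕ r) ^ 3) ⊗ eval (E (p ∸ 3)) (ι α)}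
    linear (⇝-⊗ {x = ι ((α + fromℕ r) ^ 3)} {eval (E (p ∸ 3)) (ι α)} cubic
      (⇝-eval α (value-E v v-inverse (ℕ.suc[m]≤n⇒m≤pred[n] (ℕ.<⇒≤ 3<p))
                          (p ∸ 3) (ℕ.∸-monoʳ-≤ p (s≤s z≤n)))))
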